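{- Let $G=(V,E)$ be a graph on $n$ vertices with average degree $\bar{d}$, let $K$ be a constant positive integer, and let $G'=(V,E')$ be the port-labelled multigraph described in the context. For a vertex $v$ chosen uniformly at random from $V$ and a permutation $\pi$ chosen uniformly at random over $E'$, $$\mathbb{E}_{v,\pi}[T(v,\pi)]=O(\bar{d}\cdot\log^2 n).$$
   Context: Each vertex $w$ has two ports $w^0,w^1$. The multigraph $G'$ has, for each edge $(u,v)\in E$, $K+2$ parallel copies: one copy that occupies ports $u^0$ and $v^1$, one that occupies $u^1$ and $v^0$, and $K$ copies that each occupy $u^0$ and $v^0$. Two edges $e,e'\in E'$ sharing an endpoint $w$ form a conflicting pair if both occupy the same port $w^i$ ($i\in\{0,1\}$). Given a permutation (ranking) $\pi$ of $E'$, define two recursive procedures. The edge oracle $\mathrm{EO}(e,u,\pi)$ (where $u$ is an endpoint of $e$): if $\mathrm{EO}(e,u,\pi)$ has been computed before, return the stored result; otherwise, let $e_1,\dots,e_r$ be the edges of $E'$ that form a conflicting pair with $e$ and satisfy $\pi(e_1)<\dots<\pi(e_r)<\pi(e)$, with $v_i$ the endpoint of $e_i$ not shared with $e$; for $i=1,\dots,r$, if $\mathrm{EO}(e_i,v_i,\pi)$ returns true then return false; finally return true. The vertex oracle $\mathrm{VO}(u,\pi)$: let $e_1=(u,v_1),\dots,e_r=(u,v_r)$ be the edges of $E'$ incident to $u$ with $\pi(e_1)<\dots<\pi(e_r)$; set $d\gets 0$; for $i=1,\dots,r$, if $\mathrm{EO}(e_i,v_i,\pi)$ returns true then $d\gets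 d+1$; return $d$. $T(v,\pi)$ denotes the number of (recursive) calls to the edge oracle during the execution of $\mathrm{VO}(v,\pi)$. -}

module Defs where

open import Data.Bool.Base using (Bool; true; false; if_then_else_)
open import Data.Fin.Base using (Fin; zero; _<_)
open import Data.Fin.Induction using (<-wellFounded)
open import Data.Fin.Patterns using (0F; 1F)
open import Data.Fin.Permutation using (Permutation′; _⟨$⟩ʳ_; _⟨$⟩ˡ_; insert)
import Data.Fin.Permutation as Permutation
open import Data.Fin.Properties using (_≟_; _<?_; any?)
open import Data.Integer.Base using (+_)
open import Data.List.Base
  using (List; []; _∷_; length; map; filter; concatMap; replicate; lookup;
         allFin; cartesianProduct; cartesianProductWith)
open import Data.List.Relation.Unary.All using (All; []; _∷_)
open import Data.List.Relation.Unary.All.Properties using (all-filter)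
open import Data.Maybe.Base using (Maybe; just; nothing)
open import Data.Nat.Base using (ℕ; zero; suc)
open import Data.Nat.ListAction using (sum)
open import Data.Product.Base using (∃; _×_; _,_; proj₁; proj₂)
open import Data.Product.Properties using (≡-dec)
open import Data.Rational.Base using (ℚ; 0ℚ; _/_)
open import Data.Sum.Base using (_⊎_)
open import Effect.Monad using (RawMonad)
open import Effect.Monad.State using (State; RawMonadState; monad; monadState; execState)
open import Induction.WellFounded using (Acc; acc)
open import Level using (0ℓ)
open import Relation.Binary.Core using (Rel)
open import Relation.Binary.Definitions using (Decidable; Symmetric)
open import Relation.Binary.PropositionalEquality.Core using (_≡_)
open import Relation.Nullary using (Dec; does; ¬_)
open import Relation.Nullary.Decidable using (_×-dec_; _⊎-dec_)

private
  variable
    A : Set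
    n : ℕ

-- The expectation of f at a uniformly random entry of the list.  The value on
-- the empty list is a dummy.
mean : List A → (A → ℕ) → ℚ
mean []          f = 0ℚ
mean xs@(_ ∷ ys) f = + sum (map f xs) / suc (length ys)

-- Every permutation occurs exactly once: a permutation of Fin (suc m) is
-- determined by the image j of zero and the permutation induced on the rest.
allPermutations : ∀ m → List (Permutation′ m)
allPermutations zero    = Permutation.id ∷ []
allPermutations (suc m) =
  cartesianProductWith (insert zero) (allFin (suc m)) (allPermutations m)

record Graph (n : ℕ) : Set₁ where
  field
    _~_    : Rel (Fin n) 0ℓ
    _~?_   : Decidable _~_
    sym    : Symmetric _~_
    irrefl : ∀ {v} → ¬ (v ~ v)

  degree : Fin n → ℕ
  degree v = length (filter (v ~?_) (allFin n))

  averageDegree : ℚ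
  averageDegree = mean (allFin n) degree

  -- Each undirected edge is listed once, as the pair (u , v) with u < v.
  edges : List (Fin n × Fin n)
  edges = filter (λ (u , v) → (u <? v) ×-dec (u ~? v))
                 (cartesianProduct (allFin n) (allFin n))

Port : ℕ → Set
Port n = Fin n × Fin 2

copies : ℕ → Fin n × Fin n → List (Port n × Port n)
copies K (u , v) =
  ((u , 0F) , (v , 1F)) ∷
  ((u , 1F) , (v , 0F)) ∷
  replicate K ((u , 0F) , (v , 0F))

-- The edges of G′ are the positions in this list, so that parallel copies
-- occupying the same two ports remain distinct edges.
portPairs : ℕ → Graph n → List (Port n × Port n)
portPairs K G = concatMap (copies K) (Graph.edges G)

∣E′∣ : ℕ → Graph n → ℕ
∣E′∣ K G = length (portPairs K G)

module PortMultigraph {n : ℕ} (K : ℕ) (G : Graph n) where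

  Edge : Set
  Edge = Fin (∣E′∣ K G)

  ports : Edge → Port n × Port n
  ports = lookup (portPairs K G)

  Occupies : Edge → Port n → Set
  Occupies e p = (proj₁ (ports e) ≡ p) ⊎ (proj₂ (ports e) ≡ p)

  occupies? : ∀ e p → Dec (Occupies e p)
  occupies? e p = (proj₁ (ports e) ≟ₚ p) ⊎-dec (proj₂ (ports e) ≟ₚ p)
    where
    _≟ₚ_ : (p q : Port n) → Dec (p ≡ q)
    _≟ₚ_ = ≡-dec _≟_ _≟_

  Incident : Fin n → Edge → Set
  Incident w e = ∃ λ i → Occupies e (w , i)

  incident? : ∀ w e → Dec (Incident w e)
  incident? w e = any? λ i → occupies? e (w , i)

  ConflictAt : Fin n → Edge → Edge → Set
  ConflictAt w e f = ∃ λ i → Occupies e (w , i) × Occupies f (w , i)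

  conflictAt? : ∀ w e f → Dec (ConflictAt w e f)
  conflictAt? w e f = any? λ i → occupies? e (w , i) ×-dec occupies? f (w , i)

  -- This does not ask for e ≢ f; in use, f has a smaller rank than e.
  Conflict : Edge → Edge → Set
  Conflict e f = ∃ λ w → ConflictAt w e f

  conflict? : ∀ e f → Dec (Conflict e f)
  conflict? e f = any? λ w → conflictAt? w e f

  -- The endpoint of e other than w, for w an endpoint of e.
  opposite : Edge → Fin n → Fin n
  opposite e w with (a , _) , (b , _) ← ports e =
    if does (w ≟ a) then b else a

  -- For f in conflict with e, the endpoint of f not shared with e, where the
  -- shared endpoint is the one at which both occupy the same port.  Parallel
  -- edges may conflict at both endpoints u and v of e; u is then the shared one.
  unshared : Edge → Fin n → Edge → Fin n
  unshared e u f =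
    if does (conflictAt? u e f) then opposite f u else opposite f (opposite e u)

module Oracles {n : ℕ} (K : ℕ) (G : Graph n) (π : Permutation′ (∣E′∣ K G)) where

  open PortMultigraph K G

  rank : Edge → Fin (∣E′∣ K G)
  rank e = π ⟨$⟩ʳ e

  edgesByRank : List Edge
  edgesByRank = map (π ⟨$⟩ˡ_) (allFin (∣E′∣ K G))

  LowerConflict : Edge → Edge → Set
  LowerConflict e f = Conflict e f × rank f < rank e

  lowerConflict? : ∀ e f → Dec (LowerConflict e f)
  lowerConflict? e f = conflict? e f ×-dec (rank f <? rank e)

  record Memory : Set where
    constructor memory
    field
      calls  : ℕ
      stored : Edge → Fin n → Maybe Bool

  open Memory

  initial : Memory
  initial = memory 0 (λ _ _ → nothing)

  countCall : Memory → Memory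
  countCall s = record s { calls = suc (calls s) }

  store : Edge → Fin n → Bool → Memory → Memory
  store e u b s = record s
    { stored = λ f w → if does ((f ≟ e) ×-dec (w ≟ u)) then just b else stored s f w }

  open RawMonad (monad {S = Memory}) using (pure; _>>=_; _>>_)
  open RawMonadState (monadState {S = Memory}) using (gets; modify)

  -- Every call is counted, including those answered from memory.
  EO-acc : (e : Edge) → Fin n → Acc _<_ (rank e) → State Memory Bool
  EO-acc e u (acc rec) = do
    modify countCall
    nothing ← gets (λ s → stored s e u)
      where just b → pure b
    b ← scan (filter (lowerConflict? e) edgesByRank)
             (all-filter (lowerConflict? e) edgesByRank)
    modify (store e u b)
    pure b
    where
    scan : (fs : List Edge) → All (LowerConflict e) fs → State Memory Bool
    scan []       []              = pure true
    scan (f ∷ fs) ((_ , f<e) ∷ ps) = do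
      false ← EO-acc f (unshared e u f) (rec f<e)
        where true → pure false
      scan fs ps

  EO : Edge → Fin n → State Memory Bool
  EO e u = EO-acc e u (<-wellFounded (rank e))

  VO : Fin n → State Memory ℕ
  VO u = loop (filter (incident? u) edgesByRank) 0
    where
    loop : List Edge → ℕ → State Memory ℕ
    loop []       d = pure d
    loop (e ∷ es) d = do
      b ← EO e (opposite e u)
      loop es (if b then suc d else d)

  T : Fin n → ℕ
  T v = calls (execState (VO v) initial)

expectedCalls : ℕ → Graph n → ℚ
expectedCalls {n} K G =
  mean (cartesianProduct (allFin n) (allPermutations (∣E′∣ K G)))
       (λ (v , π) → Oracles.T K G π v)

{-# OPTIONS --safe #-}

-- EO computes the greedy maximal matching of the port multigraph.  When a call enters an
-- edge e through one of its ends, all lower edges at that end are already in memory, so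
-- only the edges at the far end cause recursion.  This bounds the calls by the recursion N.
--
-- Reveal the ranking from below, one uniformly random remaining edge at a time.  The cost N
-- accumulated by an edge e is passed on to the live edges at a free port of e when e is
-- drawn; but if one of those edges is drawn before e, it closes the port and e passes nothing
-- on through it.  By this exchange a unit of cost is moved along rather than multiplied, and
-- its expected multiplicity grows by at most w / r in a draw with r edges remaining, where w
-- is the live degree of the port.
--
-- A port of live degree w stays free during x draws with probability at most (1 - w/m)^x.
-- So w = O(m log n / x) except for a polynomially small fraction of the rankings, for which
-- the trivial bound m²n + m on the number of calls is enough.  Summing m log n / (x (m - x))
-- over x gives O(log² n) calls for each edge.
module Submission where

open import Defs

-- Conditioning on small live degrees would destroy the uniformity of the later draws. The bad
-- rankings are therefore truncated, not excluded: `Tot′` stops counting at the first state in which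
-- some free port has too large a live degree. This test depends only on the history and on the set
-- of remaining edges, so the next draw is still uniform and the exchange argument applies to it
-- unchanged. What the truncation loses is charged to `crude * crowds`: `crude` bounds the calls of
-- all vertices together by a polynomial, and a tail of `2 ^ b`, with `b` a multiple of the
-- logarithm, absorbs it.
--
-- The oracle is stateful, so its analysis carries two bounds side by side through the same
-- induction: the sharp one by `N`, and the crude one by an amortised count of empty memory cells.
--
-- Expectations are kept as sums over all orderings, multiplied by `m` and by factorials, so the
-- argument stays in the natural numbers; rationals enter only when the two means are compared.

module Proof where

  open import Data.Bool.Base as Bool using (Bool; true; false; not; _∧_; if_then_else_)
  open import Data.Bool.Properties using (not-involutive)
  open import Data.Fin.Base using (Fin; zero; suc; toℕ; punchIn; punchOut) renaming (_<_ to _<ᶠ_)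
  open import Data.Fin.Permutation using (Permutation′; _⟨$⟩ˡ_; insert; inverseˡ; inverseʳ)
  import Data.Fin.Properties as Fin
  import Data.Integer.Base as ℤ
  open import Data.Integer.Base using () renaming (+_ to pos)
  import Data.Integer.Properties as ℤ
  open import Data.List.Base hiding (sum; insertAt; product)
  open import Data.List.Membership.Propositional using (_∈_)
  open import Data.List.Membership.Propositional.Properties using (∈-lookup; ∈-allFin; ∈-cartesianProduct⁺)
  open import Data.List.Properties
    using (map-++; map-∘; map-tabulate; map-upTo; tabulate-cong; length-map; length-tabulate; length-upTo;
           length-replicate; length-filter; length-reverse; filter-accept; filter-reject; ʳ++-defn; reverse-++;
           reverse-involutive; ++-identityʳ; ∷-injectiveˡ; ∷-injectiveʳ)
  open import Data.List.Relation.Binary.Permutation.Propositional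
    using (_↭_; ↭-refl; ↭-prep; ↭-swap; ↭-trans)
  open import Data.List.Relation.Binary.Permutation.Propositional.Properties using (map⁺; ↭-length)
  open import Data.List.Relation.Unary.All as All using (All; []; _∷_)
  import Data.List.Relation.Unary.All.Properties as All
  open import Data.List.Relation.Unary.Any using (here; there)
  open import Data.Maybe.Base using (Maybe; just; nothing)
  open import Data.Maybe.Properties using (just-injective)
  open import Data.Nat.Base hiding (less)
  open import Data.Nat.DivMod using (_/_; _%_; m≡m%n+[m/n]*n; m%n<n; m/n*n≤m; /-monoʳ-≤; m<n*o⇒m/o<n)
  open import Data.Nat.ListAction using (sum)
  open import Data.Nat.ListAction.Properties using (sum-++; sum-↭)
  open import Data.Nat.Logarithm using (⌊log₂_⌋; ⌊log₂⌋-mono-≤; ⌊log₂[2^n]⌋≡n)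
  open import Data.Nat.Properties
  open import Data.Nat.Tactic.RingSolver using (solve-∀)
  open import Data.Product.Base using (∃; ∃₂; _×_; _,_; proj₁; proj₂)
  open import Data.Product.Properties using (≡-dec)
  import Data.Rational.Base as ℚ
  import Data.Rational.Properties as ℚ
  open import Data.Rational.Unnormalised.Base as ℚᵘ using (mkℚᵘ; *≤*)
  import Data.Rational.Unnormalised.Properties as ℚᵘ
  open import Data.Sum.Base using (_⊎_; inj₁; inj₂; [_,_]′)
  open import Data.Vec.Functional using (insertAt)
  open import Data.Vec.Functional.Properties using (insertAt-lookup; insertAt-punchIn)
  open import Effect.Monad.State using (State; runState)
  open import Function.Base using (_∘_; id)
  open import Induction.WellFounded using (Acc; acc)
  open import Relation.Binary.Definitions using (DecidableEquality)
  open import Relation.Binary.PropositionalEquality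
  open import Relation.Nullary using (Dec; yes; no; does; contradiction; ¬_)
  open import Relation.Nullary.Decidable using (dec-true; dec-false; _×-dec_)

  private
    variable
      A B C : Set

  -- Finite sums over lists

  ∑ : List A → (A → ℕ) → ℕ
  ∑ xs f = sum (map f xs)

  ∑-mono-All : ∀ {f g : A → ℕ} {xs} → All (λ x → f x ≤ g x) xs → ∑ xs f ≤ ∑ xs g
  ∑-mono-All []         = z≤n
  ∑-mono-All (le ∷ les) = +-mono-≤ le (∑-mono-All les)

  ∑-mono : ∀ {f g : A → ℕ} xs → (∀ x → f x ≤ g x) → ∑ xs f ≤ ∑ xs g
  ∑-mono xs le = ∑-mono-All (All.universal le xs)

  ∑-cong-All : ∀ {f g : A → ℕ} {xs} → All (λ x → f x ≡ g x) xs → ∑ xs f ≡ ∑ xs g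
  ∑-cong-All []         = refl
  ∑-cong-All (eq ∷ eqs) = cong₂ _+_ eq (∑-cong-All eqs)

  ∑-cong : ∀ {f g : A → ℕ} xs → (∀ x → f x ≡ g x) → ∑ xs f ≡ ∑ xs g
  ∑-cong xs eq = ∑-cong-All (All.universal eq xs)

  ∑-+ : ∀ xs (f g : A → ℕ) → ∑ xs (λ x → f x + g x) ≡ ∑ xs f + ∑ xs g
  ∑-+ []       f g = refl
  ∑-+ (x ∷ xs) f g = trans (cong (f x + g x +_) (∑-+ xs f g)) (interchange (f x) (g x) _ _)
    where
    interchange : ∀ a b c d → a + b + (c + d) ≡ a + c + (b + d)
    interchange = solve-∀

  ∑-*ˡ : ∀ xs c (f : A → ℕ) → ∑ xs (λ x → c * f x) ≡ c * ∑ xs f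
  ∑-*ˡ []       c f = sym (*-zeroʳ c)
  ∑-*ˡ (x ∷ xs) c f = trans (cong (c * f x +_) (∑-*ˡ xs c f)) (sym (*-distribˡ-+ c (f x) _))

  ∑-*ʳ : ∀ xs c (f : A → ℕ) → ∑ xs (λ x → f x * c) ≡ ∑ xs f * c
  ∑-*ʳ xs c f = trans (∑-cong xs λ x → *-comm (f x) c) (trans (∑-*ˡ xs c f) (*-comm c _))

  ∑-const : ∀ (xs : List A) c → ∑ xs (λ _ → c) ≡ length xs * c
  ∑-const []       c = refl
  ∑-const (x ∷ xs) c = cong (c +_) (∑-const xs c)

  ∑-++ : ∀ xs ys (f : A → ℕ) → ∑ (xs ++ ys) f ≡ ∑ xs f + ∑ ys f
  ∑-++ xs ys f = trans (cong sum (map-++ f xs ys)) (sum-++ (map f xs) (map f ys))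

  ∑-map : ∀ (g : A → B) xs (f : B → ℕ) → ∑ (map g xs) f ≡ ∑ xs (f ∘ g)
  ∑-map g xs f = cong sum (sym (map-∘ xs))

  ∑-concatMap : ∀ (g : A → List B) xs (f : B → ℕ) → ∑ (concatMap g xs) f ≡ ∑ xs (λ x → ∑ (g x) f)
  ∑-concatMap g []       f = refl
  ∑-concatMap g (x ∷ xs) f = trans (∑-++ (g x) (concatMap g xs) f) (cong (∑ (g x) f +_) (∑-concatMap g xs f))

  ∑-swap : ∀ xs ys (f : A → B → ℕ) → ∑ xs (λ x → ∑ ys (f x)) ≡ ∑ ys (λ y → ∑ xs (λ x → f x y))
  ∑-swap []       ys f = sym (trans (∑-const ys 0) (*-zeroʳ (length ys)))
  ∑-swap (x ∷ xs) ys f = trans (cong (∑ ys (f x) +_) (∑-swap xs ys f)) (sym (∑-+ ys (f x) _))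

  ∑-cartesianProductWith : ∀ (g : A → B → C) xs ys (f : C → ℕ) →
    ∑ (cartesianProductWith g xs ys) f ≡ ∑ xs (λ x → ∑ ys (λ y → f (g x y)))
  ∑-cartesianProductWith g []       ys f = refl
  ∑-cartesianProductWith g (x ∷ xs) ys f =
    trans (∑-++ (map (g x) ys) _ f) (cong₂ _+_ (∑-map (g x) ys f) (∑-cartesianProductWith g xs ys f))

  ∑-↭ : ∀ {xs ys} (f : A → ℕ) → xs ↭ ys → ∑ xs f ≡ ∑ ys f
  ∑-↭ f p = sum-↭ (map⁺ f p)

  -- Random orderings

  inserts : A → List A → List (List A)
  inserts x []       = (x ∷ []) ∷ []
  inserts x (y ∷ ys) = (x ∷ y ∷ ys) ∷ map (y ∷_) (inserts x ys)

  -- Insertion mirrors the recursion of `allPermutations`. Positions are ordered, not values, so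
  -- every list of length `r` has `r !` orderings, counted with multiplicity.
  orderings : List A → List (List A)
  orderings []       = [] ∷ []
  orderings (x ∷ xs) = concatMap (inserts x) (orderings xs)

  picks : List A → List (A × List A)
  picks []       = []
  picks (x ∷ xs) = (x , xs) ∷ map (λ (y , R) → y , x ∷ R) (picks xs)

  ∑-orderings-∷ : ∀ (x : A) xs F → ∑ (orderings (x ∷ xs)) F ≡ ∑ (orderings xs) (λ o → ∑ (inserts x o) F)
  ∑-orderings-∷ x xs F = ∑-concatMap (inserts x) (orderings xs) F

  ∑-picks-∷ : ∀ (x : A) xs (F : A × List A → ℕ) →
    ∑ (picks (x ∷ xs)) F ≡ F (x , xs) + ∑ (picks xs) (λ (y , R) → F (y , x ∷ R))
  ∑-picks-∷ x xs F = cong (F (x , xs) +_) (∑-map _ (picks xs) F)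

  inserts-↭ : ∀ (x : A) o → All (_↭ x ∷ o) (inserts x o)
  inserts-↭ x []      = ↭-refl ∷ []
  inserts-↭ x (y ∷ o) =
    ↭-refl ∷ All.map⁺ (All.map (λ p → ↭-trans (↭-prep y p) (↭-swap y x ↭-refl)) (inserts-↭ x o))

  orderings-↭ : (R : List A) → All (_↭ R) (orderings R)
  orderings-↭ []       = ↭-refl ∷ []
  orderings-↭ (x ∷ xs) =
    All.concat⁺ (All.map⁺ (All.map (λ p → All.map (λ q → ↭-trans q (↭-prep x p)) (inserts-↭ x _)) (orderings-↭ xs)))

  picks-↭ : (R : List A) → All (λ (y , R′) → y ∷ R′ ↭ R) (picks R)
  picks-↭ []       = []
  picks-↭ (x ∷ xs) = ↭-refl ∷ All.map⁺ (All.map (λ p → ↭-trans (↭-swap _ x ↭-refl) (↭-prep x p)) (picks-↭ xs))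

  ∑-picks-proj₁ : ∀ R (f : A → ℕ) → ∑ (picks R) (f ∘ proj₁) ≡ ∑ R f
  ∑-picks-proj₁ []       f = refl
  ∑-picks-proj₁ (x ∷ xs) f = cong (f x +_) (trans (∑-map _ (picks xs) _) (∑-picks-proj₁ xs f))

  -- Both sides run over the ordered pairs of distinct positions of `R`. Read with draws, an edge
  -- drawn while another remains is as likely as the reverse.
  ∑-picks-swap : ∀ R (φ : A → A → ℕ) →
    ∑ (picks R) (λ (f , R′) → ∑ R′ (φ f)) ≡ ∑ (picks R) (λ (e , R′) → ∑ R′ (λ f → φ f e))
  ∑-picks-swap []       φ = refl
  ∑-picks-swap (x ∷ xs) φ = begin
    ∑ xs (φ x) + ∑ (map _ (picks xs)) _
      ≡⟨ cong (∑ xs (φ x) +_) (expand φ) ⟩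
    ∑ xs (φ x) + (∑ xs (λ y → φ y x) + ∑ (picks xs) (λ (f , R) → ∑ R (φ f)))
      ≡⟨ cong (λ t → ∑ xs (φ x) + (∑ xs (λ y → φ y x) + t)) (∑-picks-swap xs φ) ⟩
    ∑ xs (φ x) + (∑ xs (λ y → φ y x) + ∑ (picks xs) (λ (e , R) → ∑ R (λ f → φ f e)))
      ≡⟨ exchange (∑ xs (φ x)) (∑ xs (λ y → φ y x)) _ ⟩
    ∑ xs (λ y → φ y x) + (∑ xs (φ x) + ∑ (picks xs) (λ (e , R) → ∑ R (λ f → φ f e)))
      ≡⟨ cong (∑ xs (λ y → φ y x) +_) (expand (λ e f → φ f e)) ⟨
    ∑ xs (λ y → φ y x) + ∑ (map _ (picks xs)) _ ∎
    where
    open ≡-Reasoning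
    exchange : ∀ a b c → a + (b + c) ≡ b + (a + c)
    exchange = solve-∀
    expand : ∀ ψ → ∑ (map (λ (y , R) → y , x ∷ R) (picks xs)) (λ (f , R) → ∑ R (ψ f))
                 ≡ ∑ xs (λ y → ψ y x) + ∑ (picks xs) (λ (f , R) → ∑ R (ψ f))
    expand ψ = begin
      ∑ (map (λ (y , R) → y , x ∷ R) (picks xs)) (λ (f , R) → ∑ R (ψ f))
        ≡⟨ ∑-map _ (picks xs) _ ⟩
      ∑ (picks xs) (λ (y , R) → ψ y x + ∑ R (ψ y))
        ≡⟨ ∑-+ (picks xs) (λ (y , _) → ψ y x) _ ⟩
      ∑ (picks xs) (λ (y , _) → ψ y x) + ∑ (picks xs) (λ (f , R) → ∑ R (ψ f))
        ≡⟨ cong (_+ _) (∑-picks-proj₁ xs (λ y → ψ y x)) ⟩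
      ∑ xs (λ y → ψ y x) + ∑ (picks xs) (λ (f , R) → ∑ R (ψ f)) ∎

  -- orderings inserts the elements one by one; drawing them one by one gives the same multiset.
  ∑-orderings-first : ∀ (x : A) xs F →
    ∑ (orderings (x ∷ xs)) F ≡ ∑ (picks (x ∷ xs)) (λ (y , R) → ∑ (orderings R) (F ∘ (y ∷_)))
  ∑-orderings-first x []       F = sym (+-identityʳ _)
  ∑-orderings-first x (z ∷ zs) F = begin
    ∑ (orderings (x ∷ xs)) F
      ≡⟨ ∑-orderings-∷ x xs F ⟩
    ∑ (orderings xs) (λ o → ∑ (inserts x o) F)
      ≡⟨ ∑-cong (orderings xs) split ⟩
    ∑ (orderings xs) (λ o → F (x ∷ o) + later o)
      ≡⟨ ∑-+ (orderings xs) (F ∘ (x ∷_)) later ⟩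
    ∑ (orderings xs) (F ∘ (x ∷_)) + ∑ (orderings xs) later
      ≡⟨ cong (∑ (orderings xs) (F ∘ (x ∷_)) +_) (∑-orderings-first z zs later) ⟩
    ∑ (orderings xs) (F ∘ (x ∷_)) + ∑ (picks xs) (λ (y , R) → ∑ (orderings R) (later ∘ (y ∷_)))
      ≡⟨ cong (∑ (orderings xs) (F ∘ (x ∷_)) +_) (∑-cong (picks xs) λ (y , R) →
           trans (∑-cong (orderings R) λ o → ∑-map (y ∷_) (inserts x o) F)
                 (sym (∑-orderings-∷ x R (F ∘ (y ∷_))))) ⟩
    ∑ (orderings xs) (F ∘ (x ∷_)) + ∑ (picks xs) (λ (y , R) → ∑ (orderings (x ∷ R)) (F ∘ (y ∷_)))
      ≡⟨ ∑-picks-∷ x xs (λ (y , R) → ∑ (orderings R) (F ∘ (y ∷_))) ⟨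
    ∑ (picks (x ∷ xs)) (λ (y , R) → ∑ (orderings R) (F ∘ (y ∷_))) ∎
    where
    open ≡-Reasoning
    xs = z ∷ zs
    -- The insertions of `x` behind the head: the head is then the first draw, and `x` stays among
    -- the rest.
    later : List _ → ℕ
    later []      = 0
    later (y ∷ o) = ∑ (map (y ∷_) (inserts x o)) F
    split : ∀ o → ∑ (inserts x o) F ≡ F (x ∷ o) + later o
    split []      = refl
    split (y ∷ o) = refl

  length-inserts : ∀ (x : A) o → length (inserts x o) ≡ suc (length o)
  length-inserts x []      = refl
  length-inserts x (y ∷ o) = cong suc (trans (length-map (y ∷_) (inserts x o)) (length-inserts x o))

  ∑-orderings-const : ∀ (R : List A) c → ∑ (orderings R) (λ _ → c) ≡ length R ! * c
  ∑-orderings-const []       c = refl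
  ∑-orderings-const (x ∷ xs) c = begin
    ∑ (orderings (x ∷ xs)) (λ _ → c)
      ≡⟨ ∑-orderings-∷ x xs _ ⟩
    ∑ (orderings xs) (λ o → ∑ (inserts x o) (λ _ → c))
      ≡⟨ ∑-cong-All (All.map (λ {o} p → trans (∑-const (inserts x o) c)
           (cong (_* c) (trans (length-inserts x o) (cong suc (↭-length p))))) (orderings-↭ xs)) ⟩
    ∑ (orderings xs) (λ o → suc (length xs) * c)
      ≡⟨ ∑-orderings-const xs _ ⟩
    length xs ! * (suc (length xs) * c)
      ≡⟨ regroup (length xs !) (suc (length xs)) c ⟩
    suc (length xs) ! * c ∎
    where
    open ≡-Reasoning
    regroup : ∀ a b c → a * (b * c) ≡ b * a * c
    regroup = solve-∀

  map-inserts : ∀ (g : A → B) x o → map (map g) (inserts x o) ≡ inserts (g x) (map g o)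
  map-inserts g x []      = refl
  map-inserts g x (y ∷ o) = cong ((g x ∷ g y ∷ map g o) ∷_) (begin
    map (map g) (map (y ∷_) (inserts x o)) ≡⟨ map-∘ (inserts x o) ⟨
    map (λ z → g y ∷ map g z) (inserts x o) ≡⟨ map-∘ (inserts x o) ⟩
    map (g y ∷_) (map (map g) (inserts x o)) ≡⟨ cong (map (g y ∷_)) (map-inserts g x o) ⟩
    map (g y ∷_) (inserts (g x) (map g o)) ∎)
    where open ≡-Reasoning

  ∑-orderings-map : ∀ (g : A → B) R F → ∑ (orderings (map g R)) F ≡ ∑ (orderings R) (F ∘ map g)
  ∑-orderings-map g []       F = refl
  ∑-orderings-map g (x ∷ xs) F = begin
    ∑ (orderings (g x ∷ map g xs)) F
      ≡⟨ ∑-orderings-∷ (g x) (map g xs) F ⟩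
    ∑ (orderings (map g xs)) (λ o → ∑ (inserts (g x) o) F)
      ≡⟨ ∑-orderings-map g xs _ ⟩
    ∑ (orderings xs) (λ o → ∑ (inserts (g x) (map g o)) F)
      ≡⟨ ∑-cong (orderings xs) (λ o → trans (cong (λ z → ∑ z F) (sym (map-inserts g x o))) (∑-map (map g) (inserts x o) F)) ⟩
    ∑ (orderings xs) (λ o → ∑ (inserts x o) (F ∘ map g))
      ≡⟨ ∑-orderings-∷ x xs (F ∘ map g) ⟨
    ∑ (orderings (x ∷ xs)) (F ∘ map g) ∎
    where open ≡-Reasoning

  inserts-tabulate : ∀ {n} (x : A) (g : Fin n → A) →
    inserts x (tabulate g) ≡ tabulate (λ j → tabulate (insertAt g j x))
  inserts-tabulate {n = zero}  x g = refl
  inserts-tabulate {n = suc n} x g = cong ((x ∷ tabulate g) ∷_)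
    (trans (cong (map (g zero ∷_)) (inserts-tabulate x (g ∘ suc))) (map-tabulate (λ j → tabulate (insertAt (g ∘ suc) j x)) (g zero ∷_)))

  insert-zero-⟨$⟩ˡ : ∀ {m} j (π : Permutation′ m) k →
    insert zero j π ⟨$⟩ˡ k ≡ insertAt (λ i → suc (π ⟨$⟩ˡ i)) j zero k
  insert-zero-⟨$⟩ˡ j π k with j Fin.≟ k
  ... | yes refl = sym (insertAt-lookup (λ i → suc (π ⟨$⟩ˡ i)) j zero)
  ... | no  j≢k  = begin
    suc (π ⟨$⟩ˡ punchOut j≢k)
      ≡⟨ insertAt-punchIn (λ i → suc (π ⟨$⟩ˡ i)) j zero (punchOut j≢k) ⟨
    insertAt (λ i → suc (π ⟨$⟩ˡ i)) j zero (punchIn j (punchOut j≢k))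
      ≡⟨ cong (insertAt (λ i → suc (π ⟨$⟩ˡ i)) j zero) (Fin.punchIn-punchOut j≢k) ⟩
    insertAt (λ i → suc (π ⟨$⟩ˡ i)) j zero k ∎
    where open ≡-Reasoning

  -- A uniform permutation is traded for its list of elements by rank: `insert zero j π` puts `zero`
  -- at position `j` of the list of `π`, all of whose entries are shifted by `suc`.
  ∑-allPermutations : ∀ m (F : List (Fin m) → ℕ) →
    ∑ (allPermutations m) (λ π → F (map (π ⟨$⟩ˡ_) (allFin m))) ≡ ∑ (orderings (allFin m)) F
  ∑-allPermutations zero    F = refl
  ∑-allPermutations (suc m) F = begin
    ∑ (allPermutations (suc m)) (λ π → F (map (π ⟨$⟩ˡ_) (allFin (suc m))))
      ≡⟨ ∑-cartesianProductWith (insert zero) (allFin (suc m)) (allPermutations m) _ ⟩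
    ∑ (allFin (suc m)) (λ j → ∑ (allPermutations m) λ π → F (map (insert zero j π ⟨$⟩ˡ_) (allFin (suc m))))
      ≡⟨ ∑-swap (allFin (suc m)) (allPermutations m) _ ⟩
    ∑ (allPermutations m) (λ π → ∑ (allFin (suc m)) λ j → F (map (insert zero j π ⟨$⟩ˡ_) (allFin (suc m))))
      ≡⟨ ∑-cong (allPermutations m) step ⟩
    ∑ (allPermutations m) (λ π → ∑ (inserts zero (map suc (map (π ⟨$⟩ˡ_) (allFin m)))) F)
      ≡⟨ ∑-allPermutations m (λ o → ∑ (inserts zero (map suc o)) F) ⟩
    ∑ (orderings (allFin m)) (λ o → ∑ (inserts zero (map suc o)) F)
      ≡⟨ ∑-orderings-map suc (allFin m) (λ o → ∑ (inserts zero o) F) ⟨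
    ∑ (orderings (map suc (allFin m))) (λ o → ∑ (inserts zero o) F)
      ≡⟨ ∑-orderings-∷ zero (map suc (allFin m)) F ⟨
    ∑ (orderings (zero ∷ map suc (allFin m))) F
      ≡⟨ cong (λ R → ∑ (orderings (zero ∷ R)) F) (map-tabulate id suc) ⟩
    ∑ (orderings (allFin (suc m))) F ∎
    where
    open ≡-Reasoning
    step : ∀ π → ∑ (allFin (suc m)) (λ j → F (map (insert zero j π ⟨$⟩ˡ_) (allFin (suc m))))
               ≡ ∑ (inserts zero (map suc (map (π ⟨$⟩ˡ_) (allFin m)))) F
    step π = begin
      ∑ (allFin (suc m)) (λ j → F (map (insert zero j π ⟨$⟩ˡ_) (allFin (suc m))))
        ≡⟨ ∑-cong (allFin (suc m)) (λ j → cong F (trans (map-tabulate id (insert zero j π ⟨$⟩ˡ_))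
             (tabulate-cong (insert-zero-⟨$⟩ˡ j π)))) ⟩
      ∑ (allFin (suc m)) (F ∘ λ j → tabulate (insertAt g j zero))
        ≡⟨ ∑-map (λ j → tabulate (insertAt g j zero)) (allFin (suc m)) F ⟨
      ∑ (map (λ j → tabulate (insertAt g j zero)) (allFin (suc m))) F
        ≡⟨ cong (λ z → ∑ z F) (map-tabulate id (λ j → tabulate (insertAt g j zero))) ⟩
      ∑ (tabulate (λ j → tabulate (insertAt g j zero))) F
        ≡⟨ cong (λ z → ∑ z F) (inserts-tabulate zero g) ⟨
      ∑ (inserts zero (tabulate g)) F
        ≡⟨ cong (λ z → ∑ (inserts zero z) F)
             (trans (cong (map suc) (map-tabulate id (π ⟨$⟩ˡ_))) (map-tabulate (π ⟨$⟩ˡ_) suc)) ⟨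
      ∑ (inserts zero (map suc (map (π ⟨$⟩ˡ_) (allFin m)))) F ∎
      where
      g : Fin m → Fin (suc m)
      g i = suc (π ⟨$⟩ˡ i)

  -- Elementary estimates

  m<[1+m/n]*n : ∀ m n .{{_ : NonZero n}} → m < suc (m / n) * n
  m<[1+m/n]*n m n = begin-strict
    m                     ≡⟨ m≡m%n+[m/n]*n m n ⟩
    m % n + m / n * n     <⟨ +-monoˡ-< (m / n * n) (m%n<n m n) ⟩
    n + m / n * n         ∎
    where open ≤-Reasoning

  ^-distrib-* : ∀ a b n → (a * b) ^ n ≡ a ^ n * b ^ n
  ^-distrib-* a b zero    = refl
  ^-distrib-* a b (suc n) = trans (cong (a * b *_) (^-distrib-* a b n)) (regroup a b (a ^ n) (b ^ n))
    where
    regroup : ∀ a b c d → a * b * (c * d) ≡ a * c * (b * d)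
    regroup = solve-∀

  bernoulli : ∀ a w k → a ^ suc k + suc k * (w * a ^ k) ≤ (a + w) ^ suc k
  bernoulli a w zero    = ≤-reflexive (base a w)
    where
    base : ∀ a w → a * 1 + (w * 1 + 0) ≡ (a + w) * 1
    base = solve-∀
  bernoulli a w (suc k) = begin
    a ^ (2 + k) + (2 + k) * (w * a ^ (1 + k))
      ≤⟨ m≤m+n _ _ ⟩
    a ^ (2 + k) + (2 + k) * (w * a ^ (1 + k)) + suc k * (w * (w * a ^ k))
      ≡⟨ expand a w (a ^ k) k ⟩
    (a + w) * (a ^ suc k + suc k * (w * a ^ k))
      ≤⟨ *-monoʳ-≤ (a + w) (bernoulli a w k) ⟩
    (a + w) ^ (2 + k) ∎
    where
    open ≤-Reasoning
    expand : ∀ a w p k → a * (a * p) + (2 + k) * (w * (a * p)) + (1 + k) * (w * (w * p))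
                       ≡ (a + w) * (a * p + (1 + k) * (w * p))
    expand = solve-∀

  -- The second term in `bernoulli` is already as large as `a ^ suc k`.
  doubling : ∀ a w k → a ≤ suc k * w → 2 * a ^ suc k ≤ (a + w) ^ suc k
  doubling a w k a≤kw = begin
    2 * a ^ suc k                   ≡⟨ double (a ^ suc k) ⟩
    a ^ suc k + a * a ^ k           ≤⟨ +-monoʳ-≤ (a ^ suc k) (*-monoˡ-≤ (a ^ k) a≤kw) ⟩
    a ^ suc k + suc k * w * a ^ k   ≡⟨ cong (a ^ suc k +_) (*-assoc (suc k) w (a ^ k)) ⟩
    a ^ suc k + suc k * (w * a ^ k) ≤⟨ bernoulli a w k ⟩
    (a + w) ^ suc k                 ∎
    where
    open ≤-Reasoning
    double : ∀ x → 2 * x ≡ x + x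
    double = solve-∀

  -- (1 - w/m)^x ≤ 2^{-b} as soon as x ≥ 2bm/w
  decay : ∀ b m w x .{{_ : NonZero x}} → 2 * b * m ≤ w * x → 2 ^ b * (m ∸ w) ^ x ≤ m ^ x
  decay b m w x@(suc _) le with m ≤? w
  ... | yes m≤w rewrite m≤n⇒m∸n≡0 m≤w = ≤-trans (≤-reflexive (*-zeroʳ (2 ^ b))) z≤n
  decay b m zero x@(suc _) le | no m≰w = begin
    2 ^ b * m ^ x ≡⟨ cong (λ z → 2 ^ z * m ^ x) b≡0 ⟩
    1 * m ^ x     ≡⟨ *-identityˡ (m ^ x) ⟩
    m ^ x         ∎
    where
    open ≤-Reasoning
    b≡0 : b ≡ 0
    b≡0 with m*n≡0⇒m≡0∨n≡0 (2 * b) (n≤0⇒n≡0 le)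
    ... | inj₂ refl = contradiction z≤n m≰w
    ... | inj₁ eq = m+n≡0⇒m≡0 b eq
  decay b m w@(suc _) x@(suc _) le | no m≰w = begin
    2 ^ b * a ^ x                               ≡⟨ cong (λ z → 2 ^ b * a ^ z) (m+[n∸m]≡n kb≤x) ⟨
    2 ^ b * a ^ (k * b + (x ∸ k * b))           ≡⟨ cong (2 ^ b *_) (^-distribˡ-+-* a (k * b) (x ∸ k * b)) ⟩
    2 ^ b * (a ^ (k * b) * a ^ (x ∸ k * b))     ≡⟨ *-assoc (2 ^ b) _ _ ⟨
    2 ^ b * a ^ (k * b) * a ^ (x ∸ k * b)       ≡⟨ cong (λ z → 2 ^ b * z * a ^ (x ∸ k * b)) (^-*-assoc a k b) ⟨
    2 ^ b * (a ^ k) ^ b * a ^ (x ∸ k * b)       ≡⟨ cong (_* a ^ (x ∸ k * b)) (^-distrib-* 2 (a ^ k) b) ⟨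
    (2 * a ^ k) ^ b * a ^ (x ∸ k * b)           ≤⟨ *-mono-≤ (^-monoˡ-≤ b half) (^-monoˡ-≤ (x ∸ k * b) (m∸n≤m m w)) ⟩
    (m ^ k) ^ b * m ^ (x ∸ k * b)               ≡⟨ cong (_* m ^ (x ∸ k * b)) (^-*-assoc m k b) ⟩
    m ^ (k * b) * m ^ (x ∸ k * b)               ≡⟨ ^-distribˡ-+-* m (k * b) (x ∸ k * b) ⟨
    m ^ (k * b + (x ∸ k * b))                   ≡⟨ cong (m ^_) (m+[n∸m]≡n kb≤x) ⟩
    m ^ x                                       ∎
    where
    open ≤-Reasoning
    -- As `k` exceeds `m / w`, each block of `k` factors gains a factor 2. As `k * w ≤ 2 * m`, there
    -- is room for `b` blocks among the `x` factors; the factors left over are bounded by `m`.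
    a k : ℕ
    a = m ∸ w
    k = suc (m / w)
    w≤m : w ≤ m
    w≤m = <⇒≤ (≰⇒> m≰w)
    half : 2 * a ^ k ≤ m ^ k
    half = subst (λ z → 2 * a ^ k ≤ z ^ k) (m∸n+n≡m w≤m)
      (doubling a w (m / w) (≤-trans (m∸n≤m m w) (<⇒≤ (m<[1+m/n]*n m w))))
    kw≤2m : k * w ≤ 2 * m
    kw≤2m = begin
      w + m / w * w ≤⟨ +-mono-≤ w≤m (m/n*n≤m m w) ⟩
      m + m         ≡⟨ cong (m +_) (+-identityʳ m) ⟨
      2 * m         ∎
    kb≤x : k * b ≤ x
    kb≤x = *-cancelʳ-≤ (k * b) x w (begin
      k * b * w     ≡⟨ shuffle k b w ⟩
      k * w * b     ≤⟨ *-monoˡ-≤ b kw≤2m ⟩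
      2 * m * b     ≡⟨ shuffle 2 m b ⟩
      2 * b * m     ≤⟨ le ⟩
      w * x         ≡⟨ *-comm w x ⟩
      x * w         ∎)
      where
      shuffle : ∀ k b w → k * b * w ≡ k * w * b
      shuffle = solve-∀

  -- Harmonic sums and the growth rate of a draw

  module Harmonic (A : ℕ) where

    harmonic : ℕ → ℕ → ℕ
    harmonic a zero    = 0
    harmonic a (suc n) = harmonic a n + A / suc (a + n)

    harmonic-+ : ∀ a n → harmonic 0 (a + n) ≡ harmonic 0 a + harmonic a n
    harmonic-+ a zero    = trans (cong (harmonic 0) (+-identityʳ a)) (sym (+-identityʳ _))
    harmonic-+ a (suc n) = begin
      harmonic 0 (a + suc n)                           ≡⟨ cong (harmonic 0) (+-suc a n) ⟩
      harmonic 0 (a + n) + A / suc (a + n)             ≡⟨ cong (_+ A / suc (a + n)) (harmonic-+ a n) ⟩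
      harmonic 0 a + harmonic a n + A / suc (a + n)    ≡⟨ +-assoc (harmonic 0 a) _ _ ⟩
      harmonic 0 a + harmonic a (suc n)                ∎
      where open ≡-Reasoning

    harmonic-block : ∀ a n → harmonic a n ≤ n * (A / suc a)
    harmonic-block a zero    = z≤n
    harmonic-block a (suc n) = ≤-trans
      (+-mono-≤ (harmonic-block a n) (/-monoʳ-≤ A (s≤s (m≤m+n a n))))
      (≤-reflexive (+-comm (n * (A / suc a)) (A / suc a)))

    -- Dyadic blocks: the terms from `2 ^ t` up to `2 ^ suc t` are at most `2 ^ t` in number and at
    -- most `A / 2 ^ t` in size, so a block contributes at most `A`.
    harmonic≤ : ∀ t n → n < 2 ^ t → harmonic 0 n ≤ A * t
    harmonic≤ zero    zero    _ = z≤n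
    harmonic≤ zero    (suc n) (s≤s ())
    harmonic≤ (suc t) n n<2^1+t with n <? 2 ^ t
    ... | yes n<2^t = ≤-trans (harmonic≤ t n n<2^t) (*-monoʳ-≤ A (n≤1+n t))
    ... | no  n≮2^t = begin
      harmonic 0 n                         ≡⟨ cong (harmonic 0) (m+[n∸m]≡n a≤n) ⟨
      harmonic 0 (a + (n ∸ a))             ≡⟨ harmonic-+ a (n ∸ a) ⟩
      harmonic 0 a + harmonic a (n ∸ a)    ≤⟨ +-mono-≤ (harmonic≤ t a (≤-reflexive 1+a≡2^t)) (harmonic-block a (n ∸ a)) ⟩
      A * t + (n ∸ a) * (A / suc a)        ≤⟨ +-monoʳ-≤ (A * t) (*-monoˡ-≤ (A / suc a) n∸a≤1+a) ⟩
      A * t + suc a * (A / suc a)          ≡⟨ cong (A * t +_) (*-comm (suc a) (A / suc a)) ⟩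
      A * t + A / suc a * suc a            ≤⟨ +-monoʳ-≤ (A * t) (m/n*n≤m A (suc a)) ⟩
      A * t + A                            ≡⟨ +-comm (A * t) A ⟩
      A + A * t                            ≡⟨ *-suc A t ⟨
      A * suc t                            ∎
      where
      open ≤-Reasoning
      a : ℕ
      a = pred (2 ^ t)
      1+a≡2^t : suc a ≡ 2 ^ t
      1+a≡2^t = suc-pred (2 ^ t) {{m^n≢0 2 t}}
      a≤n : a ≤ n
      a≤n = ≤-trans (n≤1+n a) (≤-trans (≤-reflexive 1+a≡2^t) (≮⇒≥ n≮2^t))
      n∸a≤1+a : n ∸ a ≤ suc a
      n∸a≤1+a = m≤n+o⇒m∸n≤o n a (begin
        n             ≤⟨ ≤-pred n<2^1+t′ ⟩
        a + suc a     ∎)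
        where
        n<2^1+t′ : n < suc (a + suc a)
        n<2^1+t′ = subst (n <_) (cong₂ _+_ (sym 1+a≡2^t) (trans (+-identityʳ _) (sym 1+a≡2^t))) n<2^1+t

  module Rates (B m : ℕ) where

    open Harmonic (B * m)

    -- `B * m / x` rounded up to a safe integer. At `x = 0` this quotient is void and the trivial
    -- bound `m` on a live degree takes its place.
    share : ℕ → ℕ
    share zero    = m
    share (suc x) = suc (B * m / suc x)

    -- With x + r = m, m w = x w + r w, and each summand is at most r times one of the shares.
    rate : ℕ → ℕ
    rate r = share r + share (m ∸ r)

    rate-bound : ∀ x r w → x + r ≡ m → w ≤ r → w * x ≤ B * m → m * w ≤ r * rate r
    rate-bound x zero    zero    x+r≡m _  _    = ≤-reflexive (*-zeroʳ m)
    rate-bound x (suc r) w       x+r≡m w≤r wx≤ = begin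
      m * w                                                ≡⟨ cong (_* w) x+r≡m ⟨
      (x + suc r) * w                                      ≡⟨ *-distribʳ-+ w x (suc r) ⟩
      x * w + suc r * w                                    ≡⟨ cong (_+ suc r * w) (*-comm x w) ⟩
      w * x + suc r * w                                    ≤⟨ +-mono-≤ (≤-trans wx≤ Bm≤) (*-monoʳ-≤ (suc r) (w≤share x x+r≡m wx≤)) ⟩
      suc r * share (suc r) + suc r * share x              ≡⟨ *-distribˡ-+ (suc r) (share (suc r)) (share x) ⟨
      suc r * (share (suc r) + share x)                    ≡⟨ cong (λ z → suc r * (share (suc r) + share z)) x≡ ⟩
      suc r * rate (suc r)                                 ∎
      where
      open ≤-Reasoning
      x≡ : x ≡ m ∸ suc r
      x≡ = trans (sym (m+n∸n≡m x (suc r))) (cong (_∸ suc r) x+r≡m)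
      Bm≤ : B * m ≤ suc r * share (suc r)
      Bm≤ = ≤-trans (<⇒≤ (m<[1+m/n]*n (B * m) (suc r))) (≤-reflexive (*-comm (share (suc r)) (suc r)))
      w≤share : ∀ x → x + suc r ≡ m → w * x ≤ B * m → w ≤ share x
      w≤share zero    eq _   = ≤-trans w≤r (≤-reflexive eq)
      w≤share (suc x) _  wx≤ = *-cancelʳ-≤ w (share (suc x)) (suc x)
        (≤-trans wx≤ (<⇒≤ (m<[1+m/n]*n (B * m) (suc x))))

    shares : ℕ → ℕ
    shares zero    = 0
    shares (suc x) = shares x + share x

    shares-mono : ∀ x → shares x ≤ shares (suc x)
    shares-mono x = m≤m+n (shares x) (share x)

    shares≡ : ∀ n → shares (suc n) ≡ m + n + harmonic 0 n
    shares≡ zero    = sym (trans (+-identityʳ (m + 0)) (+-identityʳ m))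
    shares≡ (suc n) = trans (cong (_+ share (suc n)) (shares≡ n)) (regroup m n (harmonic 0 n) (B * m / suc n))
      where
      regroup : ∀ m n h q → m + n + h + (1 + q) ≡ m + (1 + n) + (h + q)
      regroup = solve-∀

    module _ (Φ : ℕ → ℕ) (Φ-zero : Φ 0 ≡ 0) (Φ-suc : ∀ r → Φ (suc r) ≡ Φ r + rate (suc r)) where

      -- The first summands of the rates are the shares at 1 up to `r`, the second those at `m ∸ r`
      -- up to `m ∸ 1`. Adding `share 0`, which is `m`, and `shares (m ∸ r)` completes both to
      -- prefix sums. `Φ` is abstract because the potential is defined over an arbitrary rate.
      Φ-shares : ∀ r → r ≤ m → Φ r + m + shares (m ∸ r) ≡ shares (suc r) + shares m
      Φ-shares zero    _   rewrite Φ-zero = refl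
      Φ-shares (suc r) r<m = begin
        Φ (suc r) + m + shares (m ∸ suc r)
          ≡⟨ cong (λ z → z + m + shares (m ∸ suc r)) (Φ-suc r) ⟩
        Φ r + (share (suc r) + share (m ∸ suc r)) + m + shares (m ∸ suc r)
          ≡⟨ regroup₁ (Φ r) (share (suc r)) (share (m ∸ suc r)) m _ ⟩
        Φ r + m + shares (suc (m ∸ suc r)) + share (suc r)
          ≡⟨ cong (λ z → Φ r + m + shares z + share (suc r)) (sym (+-∸-assoc 1 r<m)) ⟩
        Φ r + m + shares (m ∸ r) + share (suc r)
          ≡⟨ cong (_+ share (suc r)) (Φ-shares r (<⇒≤ r<m)) ⟩
        shares (suc r) + shares m + share (suc r)
          ≡⟨ regroup₂ (shares (suc r)) (shares m) (share (suc r)) ⟩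
        shares (suc (suc r)) + shares m ∎
        where
        open ≡-Reasoning
        regroup₁ : ∀ p a b m s → p + (a + b) + m + s ≡ p + m + (s + b) + a
        regroup₁ = solve-∀
        regroup₂ : ∀ a b c → a + b + c ≡ a + c + b
        regroup₂ = solve-∀

      -- With `B` and `t` both logarithmic, `Φ m / m` has the order of the squared logarithm: one
      -- factor comes from the tail bound, the other from the harmonic sum.
      Φ≤ : ∀ t → m < 2 ^ t → Φ m ≤ 2 * (2 * m + B * m * t)
      Φ≤ t m<2^t = begin
        Φ m                             ≤⟨ m≤m+n (Φ m) m ⟩
        Φ m + m                         ≤⟨ m≤m+n (Φ m + m) (shares (m ∸ m)) ⟩
        Φ m + m + shares (m ∸ m)        ≡⟨ Φ-shares m ≤-refl ⟩
        shares (suc m) + shares m       ≤⟨ +-monoʳ-≤ (shares (suc m)) (shares-mono m) ⟩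
        shares (suc m) + shares (suc m) ≡⟨ cong₂ _+_ (shares≡ m) (shares≡ m) ⟩
        m + m + harmonic 0 m + (m + m + harmonic 0 m)
          ≤⟨ +-mono-≤ (+-monoʳ-≤ (m + m) (harmonic≤ t m m<2^t)) (+-monoʳ-≤ (m + m) (harmonic≤ t m m<2^t)) ⟩
        m + m + B * m * t + (m + m + B * m * t)
          ≡⟨ regroup m (B * m * t) ⟩
        2 * (2 * m + B * m * t) ∎
        where
        open ≤-Reasoning
        regroup : ∀ m s → m + m + s + (m + m + s) ≡ 2 * (2 * m + s)
        regroup = solve-∀

  -- Greedy matching along a random ordering

  module Greedy {E P : Set} (_≟ₚ_ : DecidableEquality P) (end : E → Bool → P)
    (loopless : ∀ e → end e false ≢ end e true) where

    sides : List Bool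
    sides = false ∷ true ∷ []

    δ : P → P → ℕ
    δ p q = if does (p ≟ₚ q) then 1 else 0

    occ : E → P → ℕ
    occ f p = ∑ sides λ j → δ p (end f j)

    -- A history h lists the edges processed so far, the latest first; free and live are 0/1-valued.
    free : List E → P → ℕ
    live : List E → E → ℕ
    free []      p = 1
    free (f ∷ h) p = free h p ∸ live h f * occ f p
    live h f = free h (end f false) * free h (end f true)

    free≤1 : ∀ h p → free h p ≤ 1
    free≤1 []      p = ≤-refl
    free≤1 (f ∷ h) p = ≤-trans (m∸n≤m (free h p) (live h f * occ f p)) (free≤1 h p)

    -- A live edge occupies only free ports, and by `loopless` each of them once. This makes the
    -- truncated subtraction in `free` exact.
    live*occ≤free : ∀ h f p → live h f * occ f p ≤ free h p
    live*occ≤free h f p with p ≟ₚ end f false | p ≟ₚ end f true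
    ... | yes p≡f₀ | yes p≡f₁ = contradiction (trans (sym p≡f₀) p≡f₁) (loopless f)
    ... | yes refl | no  _    = begin
      live h f * 1 ≡⟨ *-identityʳ (live h f) ⟩
      live h f     ≤⟨ *-monoʳ-≤ (free h p) (free≤1 h (end f true)) ⟩
      free h p * 1 ≡⟨ *-identityʳ (free h p) ⟩
      free h p     ∎
      where open ≤-Reasoning
    ... | no  _    | yes refl = begin
      live h f * 1 ≡⟨ *-identityʳ (live h f) ⟩
      live h f     ≤⟨ *-monoˡ-≤ (free h p) (free≤1 h (end f false)) ⟩
      1 * free h p ≡⟨ *-identityˡ (free h p) ⟩
      free h p     ∎
      where open ≤-Reasoning
    ... | no  _    | no  _    = ≤-trans (≤-reflexive (*-zeroʳ (live h f))) z≤n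

    free-∷ : ∀ h f p → free (f ∷ h) p + live h f * occ f p ≡ free h p
    free-∷ h f p = m∸n+n≡m (live*occ≤free h f p)

    -- N h e i bounds the calls caused by EO(e) when e is entered through its end i and h
    -- are the edges of smaller rank: while e is live, an edge at end i costs one call,
    -- answered from memory, and an edge f at the other end is entered there.
    N : List E → E → Bool → ℕ
    N []      e i = 1
    N (f ∷ h) e i =
      N h e i + live h e * ∑ sides λ j → δ (end f j) (end e (not i)) * N h f j + δ (end f j) (end e i)

    liveDegree : List E → List E → P → ℕ
    liveDegree h R p = ∑ R λ f → live h f * occ f p

    liveDegree≤ : ∀ h R p → liveDegree h R p ≤ length R * free h p
    liveDegree≤ h R p = ≤-trans (∑-mono R λ f → live*occ≤free h f p) (≤-reflexive (∑-const R _))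

    -- At a free port, a draw either leaves the port free or is one of the live edges there.
    ∑-free-∷ : ∀ h R p → ∑ R (λ f → free (f ∷ h) p) + liveDegree h R p ≡ length R * free h p
    ∑-free-∷ h R p =
      trans (sym (∑-+ R _ _)) (trans (∑-cong R λ f → free-∷ h f p) (∑-const R _))

    -- The bound for `VO` summed over all vertices: every edge is tried once from each of its ends,
    -- with the edges of smaller rank as its history.
    Tot : List E → List E → ℕ
    Tot h []      = 0
    Tot h (f ∷ o) = ∑ sides (N h f) + Tot (f ∷ h) o

    live-∷ : ∀ h f g → live (f ∷ h) g ≤ live h g
    live-∷ h f g = *-mono-≤ (m∸n≤m (free h (end g false)) (live h f * occ f (end g false)))
                            (m∸n≤m (free h (end g true)) (live h f * occ f (end g true)))

    live-++ : ∀ xs h e → live (xs ++ h) e ≤ live h e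
    live-++ []       h e = ≤-refl
    live-++ (x ∷ xs) h e = ≤-trans (live-∷ (xs ++ h) x e) (live-++ xs h e)

    term≤∑-sides : ∀ (φ : Bool → ℕ) i → φ i ≤ ∑ sides φ
    term≤∑-sides φ false = m≤m+n (φ false) _
    term≤∑-sides φ true  = ≤-trans (m≤m+n (φ true) 0) (m≤n+m _ (φ false))

    δ-refl : ∀ {p q} → p ≡ q → δ p q ≡ 1
    δ-refl {p} {q} p≡q with p ≟ₚ q
    ... | yes _  = refl
    ... | no p≢q = contradiction p≡q p≢q

    δ-irrefl : ∀ {p q} → p ≢ q → δ p q ≡ 0
    δ-irrefl {p} {q} p≢q with p ≟ₚ q
    ... | yes p≡q = contradiction p≡q p≢q
    ... | no _    = refl

    occ-end : ∀ f j {p} → end f j ≡ p → 1 ≤ occ f p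
    occ-end f j eq = ≤-trans (≤-reflexive (sym (δ-refl (sym eq)))) (term≤∑-sides (λ j → δ _ (end f j)) j)

    live-avoid : ∀ h f e → (∀ i j → end f j ≢ end e i) → live (f ∷ h) e ≡ live h e
    live-avoid h f e avoid = cong₂ _*_ (one false) (one true)
      where
      one : ∀ i → free (f ∷ h) (end e i) ≡ free h (end e i)
      one i = trans (cong (λ z → free h (end e i) ∸ live h f * z)
                (cong₂ (λ a b → a + (b + 0)) (δ-irrefl (avoid i false ∘ sym)) (δ-irrefl (avoid i true ∘ sym))))
                (cong (free h (end e i) ∸_) (*-zeroʳ (live h f)))

    live-dead : ∀ h f e → live h f ≡ 0 → live (f ∷ h) e ≡ live h e
    live-dead h f e dead = cong₂ _*_ (one false) (one true)
      where
      one : ∀ i → free (f ∷ h) (end e i) ≡ free h (end e i)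
      one i = cong (λ z → free h (end e i) ∸ z * occ f (end e i)) dead

    live-blocked : ∀ h f e i j → live h f ≡ 1 → end f j ≡ end e i → live (f ∷ h) e ≡ 0
    live-blocked h f e i j alive eq = by-side i (m≤n⇒m∸n≡0 (begin
      free h (end e i)         ≤⟨ free≤1 h (end e i) ⟩
      1                        ≤⟨ occ-end f j eq ⟩
      occ f (end e i)          ≡⟨ *-identityˡ _ ⟨
      1 * occ f (end e i)      ≡⟨ cong (_* occ f (end e i)) alive ⟨
      live h f * occ f (end e i) ∎))
      where
      open ≤-Reasoning
      by-side : ∀ i → free (f ∷ h) (end e i) ≡ 0 → live (f ∷ h) e ≡ 0
      by-side false eq = cong (_* free (f ∷ h) (end e true)) eq
      by-side true  eq = trans (cong (free (f ∷ h) (end e false) *_) eq) (*-zeroʳ (free (f ∷ h) (end e false)))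

    N-∷ : ∀ h f e i → N h e i ≤ N (f ∷ h) e i
    N-∷ h f e i = m≤m+n (N h e i) _

    N-++ : ∀ xs h e i → N h e i ≤ N (xs ++ h) e i
    N-++ []       h e i = ≤-refl
    N-++ (x ∷ xs) h e i = ≤-trans (N-++ xs h e i) (N-∷ (xs ++ h) x e i)

    1≤N : ∀ h e i → 1 ≤ N h e i
    1≤N []      e i = ≤-refl
    1≤N (f ∷ h) e i = ≤-trans (1≤N h e i) (N-∷ h f e i)

    N-term : ∀ h f e i j c → live h e ≡ 1 →
      c ≤ δ (end f j) (end e (not i)) * N h f j + δ (end f j) (end e i) → c + N h e i ≤ N (f ∷ h) e i
    N-term h f e i j c alive c≤ = begin
      c + N h e i                  ≡⟨ +-comm c (N h e i) ⟩
      N h e i + c                  ≤⟨ +-monoʳ-≤ (N h e i) (≤-trans c≤ (term≤∑-sides φ j)) ⟩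
      N h e i + ∑ sides φ          ≡⟨ cong (N h e i +_) (*-identityˡ _) ⟨
      N h e i + 1 * ∑ sides φ      ≡⟨ cong (λ z → N h e i + z * ∑ sides φ) alive ⟨
      N (f ∷ h) e i                ∎
      where
      open ≤-Reasoning
      φ : Bool → ℕ
      φ j = δ (end f j) (end e (not i)) * N h f j + δ (end f j) (end e i)

    N-far : ∀ h f e i j → live h e ≡ 1 → end f j ≡ end e (not i) → N h f j + N h e i ≤ N (f ∷ h) e i
    N-far h f e i j alive eq = N-term h f e i j (N h f j) alive (≤-trans
      (≤-reflexive (sym (trans (cong (_* N h f j) (δ-refl eq)) (*-identityˡ (N h f j))))) (m≤m+n _ _))

    N-near : ∀ h f e i j → live h e ≡ 1 → end f j ≡ end e i → 1 + N h e i ≤ N (f ∷ h) e i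
    N-near h f e i j alive eq = N-term h f e i j 1 alive (≤-trans
      (≤-reflexive (sym (δ-refl eq))) (m≤n+m _ (δ (end f j) (end e (not i)) * N h f j)))

    -- Crowded states and the truncated total

    module Crowded (ports : List P) (_∈ports : ∀ p → p ∈ ports) (B m : ℕ) where

      -- The limit `B * m / length h` on a live degree, cleared of its division; no port is overfull
      -- before the first draw.
      overfull : List E → List E → P → ℕ
      overfull h R p = free h p * (if B * m <ᵇ liveDegree h R p * length h then 1 else 0)

      crowd : List E → List E → ℕ
      crowd h R = ∑ ports (overfull h R)

      -- The order of the remaining edges does not matter, so the test is decided before the next
      -- draw and can be pulled out of the sum over orderings.
      crowd-↭ : ∀ h {R R′} → R ↭ R′ → crowd h R ≡ crowd h R′
      crowd-↭ h p = ∑-cong ports λ q →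
        cong (λ d → free h q * (if B * m <ᵇ d * length h then 1 else 0)) (∑-↭ _ p)

      crowds : List E → List E → ℕ
      crowds h []      = 0
      crowds h (f ∷ o) = crowd h (f ∷ o) + crowds (f ∷ h) o

      unless : ℕ → ℕ → ℕ
      unless zero    x = x
      unless (suc _) x = 0

      -- Costs incurred before the first crowded state are kept and everything from that state on is
      -- dropped, so every draw that is charged obeys the bound on live degrees.
      Tot′ : List E → List E → ℕ
      Tot′ h []      = 0
      Tot′ h (f ∷ o) = unless (crowd h (f ∷ o)) (∑ sides (N h f) + Tot′ (f ∷ h) o)

      Tot≡Tot′ : ∀ h o → crowds h o ≡ 0 → Tot h o ≡ Tot′ h o
      Tot≡Tot′ h []      eq = refl
      Tot≡Tot′ h (f ∷ o) eq rewrite m+n≡0⇒m≡0 (crowd h (f ∷ o)) eq =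
        cong (∑ sides (N h f) +_) (Tot≡Tot′ (f ∷ h) o (m+n≡0⇒n≡0 (crowd h (f ∷ o)) eq))

      uncrowded : ∀ h R p → crowd h R ≡ 0 → free h p ≡ 0 ⊎ liveDegree h R p * length h ≤ B * m
      uncrowded h R p eq = go (zero-term (p ∈ports) eq)
        where
        zero-term : ∀ {ps} → p ∈ ps → ∑ ps (overfull h R) ≡ 0 → overfull h R p ≡ 0
        zero-term (here refl) eq = m+n≡0⇒m≡0 _ eq
        zero-term {q ∷ _} (there p∈) eq = zero-term p∈ (m+n≡0⇒n≡0 (overfull h R q) eq)
        go : overfull h R p ≡ 0 → free h p ≡ 0 ⊎ liveDegree h R p * length h ≤ B * m
        go eq with m*n≡0⇒m≡0∨n≡0 (free h p) eq
        ... | inj₁ eq₁ = inj₁ eq₁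
        ... | inj₂ eq₂ with B * m <? liveDegree h R p * length h
        ...   | no  ≮ = inj₂ (≮⇒≥ ≮)
        ...   | yes < with B * m <ᵇ liveDegree h R p * length h | <⇒<ᵇ <
        ...     | true | _ = contradiction eq₂ λ ()

      -- The potential argument

      module Average (d : ℕ → ℕ)
        (d-bound : ∀ x r w → x + r ≡ m → w ≤ r → w * x ≤ B * m → m * w ≤ r * d r) where

        Φ : ℕ → ℕ
        Φ zero    = 0
        Φ (suc r) = Φ r + d (suc r)

        -- m times the expected contribution of e, entered through end i, to the total once r
        -- edges remain: N h e i is multiplied by 1 + Φ r / m while the port is free, and the
        -- memory hits still to come at that port contribute at most another 1 + Φ r / m.
        pot : ℕ → List E → E → Bool → ℕ
        pot r h e i = m * N h e i + free h (end e i) * (N h e i * Φ r + (m + Φ r))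

        debt : List E → E → E → Bool → ℕ
        debt h f e i = live h e * ∑ sides λ j → δ (end f j) (end e (not i)) * N h f j + δ (end f j) (end e i)

        kept : ℕ → List E → E → E → Bool → ℕ
        kept r h f e i = m * N h e i + free (f ∷ h) (end e i) * (N h e i * Φ r + (m + Φ r))

        passed : ℕ → List E → E → E → ℕ
        passed r h f e = (m + Φ r) * (live h e * ∑ sides λ j → (N h f j + 1) * occ e (end f j))

        -- `debt` is the increment of `N` caused by `f`. A port of `e` that is end `j` of `f` adds
        -- `N h f j` for `e` entered at the other end and 1 for `e` entered at this one, which gives
        -- the factor `N h f j + 1` in `passed`. The increment is priced as if its port stayed free.
        pot-∷ : ∀ r h f e → ∑ sides (pot r (f ∷ h) e) ≤ ∑ sides (kept r h f e) + passed r h f e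
        pot-∷ r h f e = begin
          ∑ sides (pot r (f ∷ h) e)
            ≤⟨ ∑-mono sides one ⟩
          ∑ sides (λ i → kept r h f e i + (m + Φ r) * debt h f e i)
            ≡⟨ ∑-+ sides (kept r h f e) (λ i → (m + Φ r) * debt h f e i) ⟩
          ∑ sides (kept r h f e) + ∑ sides (λ i → (m + Φ r) * debt h f e i)
            ≡⟨ cong (∑ sides (kept r h f e) +_) (trans (∑-*ˡ sides (m + Φ r) (debt h f e)) (cong ((m + Φ r) *_) two)) ⟩
          ∑ sides (kept r h f e) + passed r h f e ∎
          where
          open ≤-Reasoning
          split : ∀ m n l u q → m * (n + l) + u * ((n + l) * q + (m + q))
                              ≡ m * n + u * (n * q + (m + q)) + (m + u * q) * l
          split = solve-∀
          one : ∀ i → pot r (f ∷ h) e i ≤ kept r h f e i + (m + Φ r) * debt h f e i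
          one i = begin
            pot r (f ∷ h) e i
              ≡⟨ split m (N h e i) (debt h f e i) (free (f ∷ h) (end e i)) (Φ r) ⟩
            kept r h f e i + (m + free (f ∷ h) (end e i) * Φ r) * debt h f e i
              ≤⟨ +-monoʳ-≤ (kept r h f e i) (*-monoˡ-≤ (debt h f e i) (+-monoʳ-≤ m
                   (≤-trans (*-monoˡ-≤ (Φ r) (free≤1 (f ∷ h) (end e i))) (≤-reflexive (*-identityˡ (Φ r)))))) ⟩
            kept r h f e i + (m + Φ r) * debt h f e i ∎
          regroup : ∀ l a₀ a₁ b₀ b₁ n₀ n₁ →
            l * (a₁ * n₀ + a₀ + (b₁ * n₁ + b₀ + 0)) + (l * (a₀ * n₀ + a₁ + (b₀ * n₁ + b₁ + 0)) + 0)
            ≡ l * ((n₀ + 1) * (a₀ + (a₁ + 0)) + ((n₁ + 1) * (b₀ + (b₁ + 0)) + 0))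
          regroup = solve-∀
          two : ∑ sides (debt h f e) ≡ live h e * ∑ sides λ j → (N h f j + 1) * occ e (end f j)
          two = regroup (live h e)
            (δ (end f false) (end e false)) (δ (end f false) (end e true))
            (δ (end f true) (end e false)) (δ (end f true) (end e true)) (N h f false) (N h f true)

        -- A closed port has no live edges, so the factor `free` on the right is harmless. At a free
        -- port, the absence of a crowd supplies the premise of `d-bound`.
        jump-rate : ∀ h R′ e i R → e ∷ R′ ↭ R → length h + length R ≡ m → crowd h R ≡ 0 →
          m * liveDegree h R′ (end e i) ≤ free h (end e i) * (length R * d (length R))
        jump-rate h R′ e i R e∷R′↭R len eq with uncrowded h R (end e i) eq
        ... | inj₁ free≡0 = begin
          m * liveDegree h R′ (end e i) ≤⟨ *-monoʳ-≤ m (liveDegree≤ h R′ (end e i)) ⟩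
          m * (length R′ * free h (end e i)) ≡⟨ cong (λ z → m * (length R′ * z)) free≡0 ⟩
          m * (length R′ * 0) ≡⟨ cong (m *_) (*-zeroʳ (length R′)) ⟩
          m * 0 ≡⟨ *-zeroʳ m ⟩
          0 ≤⟨ z≤n ⟩
          free h (end e i) * (length R * d (length R)) ∎
          where open ≤-Reasoning
        ... | inj₂ few with free h (end e i) in eq′
        ...   | zero = begin
          m * liveDegree h R′ (end e i) ≤⟨ *-monoʳ-≤ m (liveDegree≤ h R′ (end e i)) ⟩
          m * (length R′ * free h (end e i)) ≡⟨ cong (λ z → m * (length R′ * z)) eq′ ⟩
          m * (length R′ * 0) ≡⟨ cong (m *_) (*-zeroʳ (length R′)) ⟩
          m * 0 ≡⟨ *-zeroʳ m ⟩
          0 ∎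
          where open ≤-Reasoning
        ...   | suc u = begin
          m * liveDegree h R′ p ≤⟨ d-bound (length h) (length R) _ len small slow ⟩
          length R * d (length R) ≤⟨ m≤m+n _ _ ⟩
          suc u * (length R * d (length R)) ∎
          where
          open ≤-Reasoning
          p = end e i
          fewer : liveDegree h R′ p ≤ liveDegree h R p
          fewer = ≤-trans (m≤n+m _ (live h e * occ e p)) (≤-reflexive (∑-↭ _ e∷R′↭R))
          small : liveDegree h R′ p ≤ length R
          small = ≤-trans fewer (≤-trans (liveDegree≤ h R p)
            (≤-trans (*-monoʳ-≤ (length R) (free≤1 h p)) (≤-reflexive (*-identityʳ (length R)))))
          slow : liveDegree h R′ p * length h ≤ B * m
          slow = ≤-trans (*-monoˡ-≤ (length h) fewer) few

        -- For a live edge f at a free port of e, drawing e first hands N h e i over to f, while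
        -- drawing f first closes the port. Both are equally likely, so the debt is moved rather
        -- than multiplied, and only the extra m * w * N (w the live degree) has to be paid by d.
        balance : ∀ h R′ e R r → e ∷ R′ ↭ R → length R′ ≡ r → length h + length R ≡ m → crowd h R ≡ 0 →
          m * ∑ sides (N h e) + ∑ R′ (λ f → ∑ sides (kept r h f e)) + ∑ R′ (passed r h e)
          ≤ suc r * ∑ sides (pot (suc r) h e)
        balance h R′ e R r e∷R′↭R len′ len eq = begin
          m * ∑ sides (N h e) + ∑ R′ (λ f → ∑ sides (kept r h f e)) + ∑ R′ (passed r h e)
            ≡⟨ cong₂ _+_ (cong₂ _+_ (sym (∑-*ˡ sides m (N h e))) keep) pass ⟩
          ∑ sides (λ i → m * N h e i) + ∑ sides K′ + ∑ sides L
            ≡⟨ cong (_+ ∑ sides L) (∑-+ sides (λ i → m * N h e i) K′) ⟨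
          ∑ sides (λ i → m * N h e i + K′ i) + ∑ sides L
            ≡⟨ ∑-+ sides (λ i → m * N h e i + K′ i) L ⟨
          ∑ sides (λ i → m * N h e i + K′ i + L i)
            ≤⟨ ∑-mono sides one ⟩
          ∑ sides (λ i → suc r * pot (suc r) h e i)
            ≡⟨ ∑-*ˡ sides (suc r) (pot (suc r) h e) ⟩
          suc r * ∑ sides (pot (suc r) h e) ∎
          where
          open ≤-Reasoning
          X W K′ L : Bool → ℕ
          X i = N h e i * Φ r + (m + Φ r)
          W i = liveDegree h R′ (end e i)
          K′ i = r * (m * N h e i) + ∑ R′ (λ f → free (f ∷ h) (end e i)) * X i
          L i = (m + Φ r) * ((N h e i + 1) * W i)
          keep : ∑ R′ (λ f → ∑ sides (kept r h f e)) ≡ ∑ sides K′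
          keep = trans (∑-swap R′ sides (λ f → kept r h f e)) (∑-cong sides λ i →
            trans (∑-+ R′ (λ _ → m * N h e i) _)
                  (cong₂ _+_ (trans (∑-const R′ _) (cong (_* (m * N h e i)) len′)) (∑-*ʳ R′ (X i) (λ f → free (f ∷ h) (end e i)))))
          swap-factor : ∀ a b c → a * (b * c) ≡ b * (a * c)
          swap-factor = solve-∀
          pass : ∑ R′ (passed r h e) ≡ ∑ sides L
          pass = begin-equality
            ∑ R′ (passed r h e)
              ≡⟨ ∑-*ˡ R′ (m + Φ r) _ ⟩
            (m + Φ r) * ∑ R′ (λ f → live h f * ∑ sides λ i → (N h e i + 1) * occ f (end e i))
              ≡⟨ cong ((m + Φ r) *_) (∑-cong R′ λ f → trans (sym (∑-*ˡ sides (live h f) (λ i → (N h e i + 1) * occ f (end e i))))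
                   (∑-cong sides λ i → swap-factor (live h f) (N h e i + 1) (occ f (end e i)))) ⟩
            (m + Φ r) * ∑ R′ (λ f → ∑ sides λ i → (N h e i + 1) * (live h f * occ f (end e i)))
              ≡⟨ cong ((m + Φ r) *_) (trans (∑-swap R′ sides (λ f i → (N h e i + 1) * (live h f * occ f (end e i))))
                   (∑-cong sides λ i → ∑-*ˡ R′ (N h e i + 1) (λ f → live h f * occ f (end e i)))) ⟩
            (m + Φ r) * ∑ sides (λ i → (N h e i + 1) * W i)
              ≡⟨ ∑-*ˡ sides (m + Φ r) (λ i → (N h e i + 1) * W i) ⟨
            ∑ sides L ∎
          -- Of the draws, `s` leave the port free and `w` close it. Since `(m + q) * (n + 1)`
          -- equals `(n * q + (m + q)) + m * n`, what is passed on makes up for the `w` closed cases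
          -- and exceeds them only by `n * (m * w)`, which `d` pays.
          collect : ∀ m n r s w u q d → s + w ≡ r * u → m * w ≤ u * (suc r * d) →
            m * n + (r * (m * n) + s * (n * q + (m + q))) + (m + q) * ((n + 1) * w)
            ≤ suc r * (m * n + u * (n * (q + d) + (m + (q + d))))
          collect m n r s w u q d s+w≡ru mw≤ = begin
            m * n + (r * (m * n) + s * (n * q + (m + q))) + (m + q) * ((n + 1) * w)
              ≡⟨ collect₁ m n r s w q ⟩
            suc r * (m * n) + (s + w) * (n * q + (m + q)) + n * (m * w)
              ≤⟨ +-mono-≤ (+-monoʳ-≤ (suc r * (m * n)) (≤-reflexive (cong (_* (n * q + (m + q))) s+w≡ru)))
                          (*-monoʳ-≤ n mw≤) ⟩
            suc r * (m * n) + r * u * (n * q + (m + q)) + n * (u * (suc r * d))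
              ≤⟨ m≤m+n _ (u * (n * q + (m + q)) + suc r * (u * d)) ⟩
            suc r * (m * n) + r * u * (n * q + (m + q)) + n * (u * (suc r * d)) + (u * (n * q + (m + q)) + suc r * (u * d))
              ≡⟨ collect₂ m n r u q d ⟩
            suc r * (m * n + u * (n * (q + d) + (m + (q + d)))) ∎
            where
            collect₁ : ∀ m n r s w q →
              m * n + (r * (m * n) + s * (n * q + (m + q))) + (m + q) * ((n + 1) * w)
              ≡ (1 + r) * (m * n) + (s + w) * (n * q + (m + q)) + n * (m * w)
            collect₁ = solve-∀
            collect₂ : ∀ m n r u q d →
              (1 + r) * (m * n) + r * u * (n * q + (m + q)) + n * (u * ((1 + r) * d)) + (u * (n * q + (m + q)) + (1 + r) * (u * d))
              ≡ (1 + r) * (m * n + u * (n * (q + d) + (m + (q + d))))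
            collect₂ = solve-∀
          lenR : length R ≡ suc r
          lenR = trans (sym (↭-length e∷R′↭R)) (cong suc len′)
          one : ∀ i → m * N h e i + K′ i + L i ≤ suc r * pot (suc r) h e i
          one i = collect m (N h e i) r _ (W i) (free h (end e i)) (Φ r) (d (suc r))
            (trans (∑-free-∷ h R′ (end e i)) (cong (_* free h (end e i)) len′))
            (subst (λ z → m * W i ≤ free h (end e i) * (z * d z)) lenR (jump-rate h R′ e i R e∷R′↭R len eq))

        balance-∑ : ∀ h R r → length R ≡ suc r → length h + length R ≡ m → crowd h R ≡ 0 →
          ∑ (picks R) (λ (f , R′) → m * ∑ sides (N h f) + ∑ R′ (λ e → ∑ sides (pot r (f ∷ h) e)))
          ≤ suc r * ∑ R (λ e → ∑ sides (pot (suc r) h e))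
        balance-∑ h R r lenR len eq = begin
          ∑ ps (λ (f , R′) → own f + ∑ R′ (λ e → ∑ sides (pot r (f ∷ h) e)))
            ≤⟨ ∑-mono ps (λ (f , R′) → +-monoʳ-≤ (own f) (∑-mono R′ (pot-∷ r h f))) ⟩
          ∑ ps (λ (f , R′) → own f + ∑ R′ (λ e → K₁ f e + passed r h f e))
            ≡⟨ ∑-cong ps (λ (f , R′) → trans (cong (own f +_) (∑-+ R′ (K₁ f) (passed r h f))) (sym (+-assoc (own f) _ _))) ⟩
          ∑ ps (λ (f , R′) → own f + ∑ R′ (K₁ f) + ∑ R′ (passed r h f))
            ≡⟨ trans (∑-+ ps _ _) (cong₂ _+_ (∑-+ ps _ _) refl) ⟩
          ∑ ps (λ (f , R′) → own f) + ∑ ps (λ (f , R′) → ∑ R′ (K₁ f)) + ∑ ps (λ (f , R′) → ∑ R′ (passed r h f))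
            -- The exchange: what `e` keeps when some `f` is drawn is regrouped under `e`, next to
            -- what `e` costs and passes on when it is drawn itself. Each summand then concerns a
            -- single `e`.
            ≡⟨ cong₂ _+_ (cong (∑ ps (λ (f , R′) → own f) +_) (∑-picks-swap R K₁)) refl ⟩
          ∑ ps (λ (e , R′) → own e) + ∑ ps (λ (e , R′) → ∑ R′ (λ f → K₁ f e)) + ∑ ps (λ (e , R′) → ∑ R′ (passed r h e))
            ≡⟨ trans (∑-+ ps _ _) (cong₂ _+_ (∑-+ ps _ _) refl) ⟨
          ∑ ps (λ (e , R′) → own e + ∑ R′ (λ f → K₁ f e) + ∑ R′ (passed r h e))
            ≤⟨ ∑-mono-All (All.map (λ {(e , R′)} p → balance h R′ e R r p
                 (suc-injective (trans (↭-length p) lenR)) len eq) (picks-↭ R)) ⟩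
          ∑ ps (λ (e , R′) → suc r * ∑ sides (pot (suc r) h e))
            ≡⟨ ∑-*ˡ ps (suc r) _ ⟩
          suc r * ∑ ps (λ (e , R′) → ∑ sides (pot (suc r) h e))
            ≡⟨ cong (suc r *_) (∑-picks-proj₁ R (λ e → ∑ sides (pot (suc r) h e))) ⟩
          suc r * ∑ R (λ e → ∑ sides (pot (suc r) h e)) ∎
          where
          open ≤-Reasoning
          ps = picks R
          own : E → ℕ
          own f = m * ∑ sides (N h f)
          K₁ : E → E → ℕ
          K₁ f e = ∑ sides (kept r h f e)

        -- The summed potential dominates: by `balance-∑`, the cost of the drawn edge plus the
        -- potential left behind is on average at most the potential before the draw. A crowded
        -- state contributes 0.
        ∑-Tot′ : ∀ r R h → length R ≡ r → length h + length R ≡ m →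
          m * ∑ (orderings R) (Tot′ h) ≤ r ! * ∑ R (λ e → ∑ sides (pot r h e))
        ∑-Tot′ zero    []         h lenR len = ≤-reflexive (*-zeroʳ m)
        ∑-Tot′ (suc r) R@(x ∷ xs) h lenR len = begin
          m * ∑ (orderings R) (Tot′ h)
            ≡⟨ cong (m *_) (∑-orderings-first x xs (Tot′ h)) ⟩
          m * ∑ (picks R) (λ (f , R′) → ∑ (orderings R′) (λ o → Tot′ h (f ∷ o)))
            ≡⟨ cong (m *_) (∑-cong-All (All.map (λ {(f , R′)} p → ∑-cong-All (All.map (λ {o} q →
                 cong (λ c → unless c (∑ sides (N h f) + Tot′ (f ∷ h) o)) (crowd-↭ h (↭-trans (↭-prep f q) p)))
                 (orderings-↭ R′))) (picks-↭ R))) ⟩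
          m * ∑ (picks R) (λ (f , R′) → ∑ (orderings R′) (λ o → unless (crowd h R) (∑ sides (N h f) + Tot′ (f ∷ h) o)))
            ≤⟨ gated (crowd h R) refl ⟩
          suc r ! * ∑ R (λ e → ∑ sides (pot (suc r) h e)) ∎
          where
          open ≤-Reasoning
          regroup₁ : ∀ a b c → a * (b * c) ≡ b * (a * c)
          regroup₁ = solve-∀
          regroup₂ : ∀ a b c → a * (b * c) ≡ b * a * c
          regroup₂ = solve-∀
          gated : ∀ c → crowd h R ≡ c →
            m * ∑ (picks R) (λ (f , R′) → ∑ (orderings R′) (λ o → unless c (∑ sides (N h f) + Tot′ (f ∷ h) o)))
            ≤ suc r ! * ∑ R (λ e → ∑ sides (pot (suc r) h e))
          gated (suc c) eq = begin
            m * ∑ (picks R) (λ (f , R′) → ∑ (orderings R′) (λ o → 0))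
              ≡⟨ cong (m *_) (trans (∑-cong (picks R) λ (f , R′) →
                   trans (∑-const (orderings R′) 0) (*-zeroʳ (length (orderings R′))))
                   (trans (∑-const (picks R) 0) (*-zeroʳ (length (picks R))))) ⟩
            m * 0 ≡⟨ *-zeroʳ m ⟩
            0     ≤⟨ z≤n ⟩
            suc r ! * ∑ R (λ e → ∑ sides (pot (suc r) h e)) ∎
          gated zero    eq = begin
            m * ∑ (picks R) (λ (f , R′) → ∑ (orderings R′) (λ o → ∑ sides (N h f) + Tot′ (f ∷ h) o))
              ≡⟨ ∑-*ˡ (picks R) m _ ⟨
            ∑ (picks R) (λ (f , R′) → m * ∑ (orderings R′) (λ o → ∑ sides (N h f) + Tot′ (f ∷ h) o))
              ≤⟨ ∑-mono-All (All.map (λ {(f , R′)} p → draw f R′ p) (picks-↭ R)) ⟩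
            ∑ (picks R) (λ (f , R′) → r ! * (m * ∑ sides (N h f) + ∑ R′ (λ e → ∑ sides (pot r (f ∷ h) e))))
              ≡⟨ ∑-*ˡ (picks R) (r !) _ ⟩
            r ! * ∑ (picks R) (λ (f , R′) → m * ∑ sides (N h f) + ∑ R′ (λ e → ∑ sides (pot r (f ∷ h) e)))
              ≤⟨ *-monoʳ-≤ (r !) (balance-∑ h R r lenR len eq) ⟩
            r ! * (suc r * ∑ R (λ e → ∑ sides (pot (suc r) h e)))
              ≡⟨ regroup₂ (r !) (suc r) _ ⟩
            suc r ! * ∑ R (λ e → ∑ sides (pot (suc r) h e)) ∎
            where
            draw : ∀ f R′ → f ∷ R′ ↭ R →
              m * ∑ (orderings R′) (λ o → ∑ sides (N h f) + Tot′ (f ∷ h) o)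
              ≤ r ! * (m * ∑ sides (N h f) + ∑ R′ (λ e → ∑ sides (pot r (f ∷ h) e)))
            draw f R′ p = begin
              m * ∑ (orderings R′) (λ o → ∑ sides (N h f) + Tot′ (f ∷ h) o)
                ≡⟨ cong (m *_) (trans (∑-+ (orderings R′) _ _) (cong₂ _+_ (trans (∑-orderings-const R′ _) (cong (λ z → z ! * ∑ sides (N h f)) lenR′)) refl)) ⟩
              m * (r ! * ∑ sides (N h f) + ∑ (orderings R′) (Tot′ (f ∷ h)))
                ≡⟨ *-distribˡ-+ m _ _ ⟩
              m * (r ! * ∑ sides (N h f)) + m * ∑ (orderings R′) (Tot′ (f ∷ h))
                ≤⟨ +-mono-≤ (≤-reflexive (regroup₁ m (r !) _)) (∑-Tot′ r R′ (f ∷ h) lenR′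
                     (trans (cong (λ z → suc (length h) + z) lenR′)
                       (trans (sym (+-suc (length h) r)) (trans (cong (length h +_) (sym lenR)) len)))) ⟩
              r ! * (m * ∑ sides (N h f)) + r ! * ∑ R′ (λ e → ∑ sides (pot r (f ∷ h) e))
                ≡⟨ *-distribˡ-+ (r !) _ _ ⟨
              r ! * (m * ∑ sides (N h f) + ∑ R′ (λ e → ∑ sides (pot r (f ∷ h) e))) ∎
              where
              lenR′ : length R′ ≡ r
              lenR′ = suc-injective (trans (↭-length p) lenR)

    -- Tail bound for the live degree of a free port

    [_≤] : ℕ → ℕ → ℕ
    [ w ≤] d = if w ≤ᵇ d then 1 else 0

    [≤]-yes : ∀ {w d} → w ≤ d → [ w ≤] d ≡ 1
    [≤]-yes {w} {d} w≤d with w ≤ᵇ d | ≤⇒≤ᵇ w≤d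
    ... | true | _ = refl

    [≤]-mono : ∀ w {c d} → c ≤ d → [ w ≤] c ≤ [ w ≤] d
    [≤]-mono w {c} {d} c≤d with w ≤ᵇ c in eq
    ... | false = z≤n
    ... | true  = ≤-reflexive (sym ([≤]-yes (≤-trans (≤ᵇ⇒≤ w c (subst Bool.T (sym eq) _)) c≤d)))

    heavy : ℕ → List E → List E → P → ℕ
    heavy w h R p = free h p * [ w ≤] (liveDegree h R p)

    heavy-↭ : ∀ w h p {R R′} → R ↭ R′ → heavy w h R p ≡ heavy w h R′ p
    heavy-↭ w h p R↭R′ = cong (λ d → free h p * [ w ≤] d) (∑-↭ _ R↭R′)

    heavy≤1 : ∀ w h R p → heavy w h R p ≤ 1
    heavy≤1 w h R p with w ≤ᵇ liveDegree h R p
    ... | true  = ≤-trans (≤-reflexive (*-identityʳ (free h p))) (free≤1 h p)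
    ... | false = ≤-trans (≤-reflexive (*-zeroʳ (free h p))) z≤n

    later : ℕ → ℕ → List E → List E → P → ℕ
    later zero    w h o       p = heavy w h o p
    later (suc x) w h []      p = 0
    later (suc x) w h (f ∷ o) p = later x w (f ∷ h) o p

    -- Live degrees only fall, so a port that is heavy after a draw saw `w` live edges before it. It
    -- remains to ask whether the draw left the port free.
    heavy-∷ : ∀ w h f R′ R p → f ∷ R′ ↭ R → heavy w (f ∷ h) R′ p ≤ free (f ∷ h) p * [ w ≤] (liveDegree h R p)
    heavy-∷ w h f R′ R p f∷R′↭R = *-monoʳ-≤ (free (f ∷ h) p) ([≤]-mono w (begin
      liveDegree (f ∷ h) R′ p ≤⟨ ∑-mono R′ (λ g → *-monoˡ-≤ (occ g p) (live-∷ h f g)) ⟩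
      liveDegree h R′ p       ≤⟨ m≤n+m _ (live h f * occ f p) ⟩
      liveDegree h (f ∷ R′) p ≡⟨ ∑-↭ _ f∷R′↭R ⟩
      liveDegree h R p        ∎))
      where open ≤-Reasoning

    -- A port seeing w live edges is matched by each draw with probability at least w/m.
    draw-heavy : ∀ m w h R p → length R ≤ m →
      m * (∑ R (λ f → free (f ∷ h) p) * [ w ≤] (liveDegree h R p)) ≤ (m ∸ w) * (length R * heavy w h R p)
    draw-heavy m w h R p r≤m with w ≤ᵇ liveDegree h R p in eq
    ... | false = ≤-trans (≤-reflexive (trans (cong (m *_) (*-zeroʳ (∑ R _))) (*-zeroʳ m))) z≤n
    ... | true  = begin
      m * (∑ R (λ f → free (f ∷ h) p) * 1)      ≡⟨ cong (m *_) (*-identityʳ _) ⟩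
      m * s                                     ≤⟨ by-free (free h p) (free≤1 h p) (∑-free-∷ h R p) ⟩
      (m ∸ w) * (r * free h p)                  ≡⟨ cong (λ z → (m ∸ w) * (r * z)) (*-identityʳ (free h p)) ⟨
      (m ∸ w) * (r * (free h p * 1))            ∎
      where
      open ≤-Reasoning
      s r D : ℕ
      s = ∑ R (λ f → free (f ∷ h) p)
      r = length R
      D = liveDegree h R p
      w≤D : w ≤ D
      w≤D = ≤ᵇ⇒≤ w D (subst Bool.T (sym eq) _)
      by-free : ∀ u → u ≤ 1 → s + D ≡ r * u → m * s ≤ (m ∸ w) * (r * u)
      by-free zero    _ s+D≡ = ≤-trans (≤-reflexive (trans (cong (m *_) (m+n≡0⇒m≡0 s (trans s+D≡ (*-zeroʳ r)))) (*-zeroʳ m))) z≤n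
      by-free (suc zero) _ s+D≡ = begin
        m * s                ≤⟨ *-monoʳ-≤ m s≤ ⟩
        m * (r ∸ w)          ≡⟨ *-distribˡ-∸ m r w ⟩
        m * r ∸ m * w        ≤⟨ ∸-monoʳ-≤ (m * r) (≤-trans (*-monoʳ-≤ w r≤m) (≤-reflexive (*-comm w m))) ⟩
        m * r ∸ w * r        ≡⟨ *-distribʳ-∸ r m w ⟨
        (m ∸ w) * r          ≡⟨ cong ((m ∸ w) *_) (*-identityʳ r) ⟨
        (m ∸ w) * (r * 1)    ∎
        where
        s≤ : s ≤ r ∸ w
        s≤ = begin
          s         ≡⟨ m+n∸n≡m s D ⟨
          s + D ∸ D ≡⟨ cong (_∸ D) (trans s+D≡ (*-identityʳ r)) ⟩
          r ∸ D     ≤⟨ ∸-monoʳ-≤ r w≤D ⟩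
          r ∸ w     ∎
      by-free (suc (suc _)) (s≤s ()) _

    -- A port that is heavy after `x` draws was heavy at each of them and survived each; by
    -- `draw-heavy`, every survival costs a factor `(m ∸ w) / m`.
    ∑-later : ∀ m w x R h p → length R ≤ m →
      m ^ x * ∑ (orderings R) (λ o → later x w h o p) ≤ (m ∸ w) ^ x * (length R ! * heavy w h R p)
    ∑-later m w zero R h p r≤m = ≤-reflexive (cong (1 *_) (begin
      ∑ (orderings R) (λ o → heavy w h o p)
        ≡⟨ ∑-cong-All (All.map (heavy-↭ w h p) (orderings-↭ R)) ⟩
      ∑ (orderings R) (λ o → heavy w h R p)
        ≡⟨ ∑-orderings-const R (heavy w h R p) ⟩
      length R ! * heavy w h R p ∎))
      where open ≡-Reasoning
    ∑-later m w (suc x) [] h p r≤m =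
      ≤-trans (≤-reflexive (*-zeroʳ (m ^ suc x))) z≤n
    ∑-later m w (suc x) R@(y ∷ ys) h p r≤m = begin
      m ^ suc x * ∑ (orderings R) (λ o → later (suc x) w h o p)
        ≡⟨ cong (m ^ suc x *_) (∑-orderings-first y ys _) ⟩
      m * m ^ x * ∑ (picks R) (λ (f , R′) → ∑ (orderings R′) (λ o → later x w (f ∷ h) o p))
        ≡⟨ *-assoc m (m ^ x) _ ⟩
      m * (m ^ x * ∑ (picks R) (λ (f , R′) → ∑ (orderings R′) (λ o → later x w (f ∷ h) o p)))
        ≡⟨ cong (m *_) (∑-*ˡ (picks R) (m ^ x) _) ⟨
      m * ∑ (picks R) (λ (f , R′) → m ^ x * ∑ (orderings R′) (λ o → later x w (f ∷ h) o p))
        ≤⟨ *-monoʳ-≤ m (∑-mono-All (All.map (λ {(f , R′)} q → draw f R′ q) (picks-↭ R))) ⟩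
      m * ∑ (picks R) (λ (f , R′) → (m ∸ w) ^ x * (length ys ! * (free (f ∷ h) p * ι)))
        ≡⟨ cong (m *_) (∑-picks-proj₁ R (λ f → (m ∸ w) ^ x * (length ys ! * (free (f ∷ h) p * ι)))) ⟩
      m * ∑ R (λ f → (m ∸ w) ^ x * (length ys ! * (free (f ∷ h) p * ι)))
        ≡⟨ cong (m *_) (trans (∑-*ˡ R ((m ∸ w) ^ x) _) (cong ((m ∸ w) ^ x *_)
             (trans (∑-*ˡ R (length ys !) _) (cong (length ys ! *_) (∑-*ʳ R ι (λ f → free (f ∷ h) p)))))) ⟩
      m * ((m ∸ w) ^ x * (length ys ! * (∑ R (λ f → free (f ∷ h) p) * ι)))
        ≡⟨ regroup₁ m ((m ∸ w) ^ x) (length ys !) _ ⟩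
      (m ∸ w) ^ x * (length ys ! * (m * (∑ R (λ f → free (f ∷ h) p) * ι)))
        ≤⟨ *-monoʳ-≤ ((m ∸ w) ^ x) (*-monoʳ-≤ (length ys !) (draw-heavy m w h R p r≤m)) ⟩
      (m ∸ w) ^ x * (length ys ! * ((m ∸ w) * (length R * heavy w h R p)))
        ≡⟨ regroup₂ ((m ∸ w) ^ x) (length ys !) (m ∸ w) (length R) _ ⟩
      (m ∸ w) ^ suc x * (length R ! * heavy w h R p) ∎
      where
      open ≤-Reasoning
      ι : ℕ
      ι = [ w ≤] (liveDegree h R p)
      regroup₁ : ∀ a b c d → a * (b * (c * d)) ≡ b * (c * (a * d))
      regroup₁ = solve-∀
      regroup₂ : ∀ a b c d e → a * (b * (c * (d * e))) ≡ c * a * (d * b * e)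
      regroup₂ = solve-∀
      draw : ∀ f R′ → f ∷ R′ ↭ R →
        m ^ x * ∑ (orderings R′) (λ o → later x w (f ∷ h) o p) ≤ (m ∸ w) ^ x * (length ys ! * (free (f ∷ h) p * ι))
      draw f R′ q = begin
        m ^ x * ∑ (orderings R′) (λ o → later x w (f ∷ h) o p)
          ≤⟨ ∑-later m w x R′ (f ∷ h) p (≤-trans (≤-reflexive len) (≤-trans (n≤1+n _) r≤m)) ⟩
        (m ∸ w) ^ x * (length R′ ! * heavy w (f ∷ h) R′ p)
          ≤⟨ *-monoʳ-≤ ((m ∸ w) ^ x) (*-mono-≤ (≤-reflexive (cong _! len)) (heavy-∷ w h f R′ R p q)) ⟩
        (m ∸ w) ^ x * (length ys ! * (free (f ∷ h) p * ι)) ∎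
        where
        len : length R′ ≡ length ys
        len = suc-injective (↭-length q)

    module Tail (ports : List P) (_∈ports : ∀ p → p ∈ ports) (b m : ℕ) where

      β : ℕ
      β = 2 * b

      open Crowded ports _∈ports β m

      -- The least live degree that is overfull after x draws (never reached for x = 0).
      threshold : ℕ → ℕ
      threshold zero    = suc m
      threshold (suc x) = suc ((β * m) / suc x)

      overfull≤heavy : ∀ h R p → overfull h R p ≤ heavy (threshold (length h)) h R p
      overfull≤heavy h R p = *-monoʳ-≤ (free h p) (go (length h))
        where
        D = liveDegree h R p
        go : ∀ x → (if β * m <ᵇ D * x then 1 else 0) ≤ [ threshold x ≤] D
        go x with β * m <ᵇ D * x in eq
        ... | false = z≤n
        go zero    | true = contradiction (<ᵇ⇒< (β * m) (D * 0) (subst Bool.T (sym eq) _))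
                              (≤⇒≯ (≤-trans (≤-reflexive (*-zeroʳ D)) z≤n))
        go (suc x) | true = ≤-reflexive (sym ([≤]-yes (m<n*o⇒m/o<n {n = D} {suc x} (<ᵇ⇒< (β * m) (D * suc x) (subst Bool.T (sym eq) _)))))

      crowds≤later : ∀ h o →
        crowds h o ≤ ∑ (upTo (length o)) (λ y → ∑ ports (later y (threshold (length h + y)) h o))
      crowds≤later h []      = z≤n
      crowds≤later h (f ∷ o) = +-mono-≤
        (∑-mono ports λ p → ≤-trans (overfull≤heavy h (f ∷ o) p)
          (≤-reflexive (cong (λ z → heavy (threshold z) h (f ∷ o) p) (sym (+-identityʳ (length h))))))
        (≤-trans (crowds≤later (f ∷ h) o) (≤-reflexive (begin
          ∑ (upTo (length o)) (λ y → ∑ ports (later y (threshold (suc (length h) + y)) (f ∷ h) o))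
            ≡⟨ ∑-cong (upTo (length o)) (λ y → cong (λ z → ∑ ports (later y (threshold z) (f ∷ h) o)) (sym (+-suc (length h) y))) ⟩
          ∑ (upTo (length o)) (λ y → ∑ ports (later (suc y) (threshold (length h + suc y)) h (f ∷ o)))
            ≡⟨ ∑-map suc (upTo (length o)) _ ⟨
          ∑ (map suc (upTo (length o))) (λ y → ∑ ports (later y (threshold (length h + y)) h (f ∷ o)))
            ≡⟨ cong (λ z → ∑ z (λ y → ∑ ports (later y (threshold (length h + y)) h (f ∷ o)))) (map-upTo suc (length o)) ⟩
          ∑ (applyUpTo suc (length o)) (λ y → ∑ ports (later y (threshold (length h + y)) h (f ∷ o))) ∎)))
        where open ≡-Reasoning

      heavy-zero : ∀ R p → length R ≤ m → heavy (threshold 0) [] R p ≡ 0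
      heavy-zero R p r≤m with suc m ≤ᵇ liveDegree [] R p in eq
      ... | false = refl
      ... | true  = contradiction (≤ᵇ⇒≤ (suc m) _ (subst Bool.T (sym eq) _)) (≤⇒≯
        (≤-trans (liveDegree≤ [] R p) (≤-trans (≤-reflexive (*-identityʳ (length R))) r≤m)))

      -- For positive `x` the threshold exceeds `2 * b * m / x`, which is what `decay` asks for;
      -- this fixes the choice of `β`.
      ∑-later-threshold : .{{_ : NonZero m}} → ∀ x R p → length R ≤ m →
        2 ^ b * ∑ (orderings R) (λ o → later x (threshold x) [] o p) ≤ length R !
      ∑-later-threshold zero R p r≤m = begin
        2 ^ b * ∑ (orderings R) (λ o → heavy (threshold 0) [] o p)
          ≡⟨ cong (2 ^ b *_) (∑-cong-All (All.map (λ q → trans (heavy-↭ (threshold 0) [] p q) (heavy-zero R p r≤m)) (orderings-↭ R))) ⟩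
        2 ^ b * ∑ (orderings R) (λ o → 0)
          ≡⟨ cong (2 ^ b *_) (trans (∑-const (orderings R) 0) (*-zeroʳ (length (orderings R)))) ⟩
        2 ^ b * 0
          ≡⟨ *-zeroʳ (2 ^ b) ⟩
        0 ≤⟨ z≤n ⟩
        length R ! ∎
        where open ≤-Reasoning
      ∑-later-threshold (suc x) R p r≤m = *-cancelˡ-≤ (m ^ suc x) {{m^n≢0 m (suc x)}} (begin
        m ^ suc x * (2 ^ b * S)
          ≡⟨ regroup (m ^ suc x) (2 ^ b) S ⟩
        2 ^ b * (m ^ suc x * S)
          ≤⟨ *-monoʳ-≤ (2 ^ b) (∑-later m w (suc x) R [] p r≤m) ⟩
        2 ^ b * ((m ∸ w) ^ suc x * (length R ! * heavy w [] R p))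
          ≡⟨ *-assoc (2 ^ b) _ _ ⟨
        2 ^ b * (m ∸ w) ^ suc x * (length R ! * heavy w [] R p)
          ≤⟨ *-mono-≤ (decay b m w (suc x) (<⇒≤ (m<[1+m/n]*n (β * m) (suc x))))
                      (≤-trans (*-monoʳ-≤ (length R !) (heavy≤1 w [] R p)) (≤-reflexive (*-identityʳ _))) ⟩
        m ^ suc x * length R ! ∎)
        where
        open ≤-Reasoning
        w S : ℕ
        w = threshold (suc x)
        S = ∑ (orderings R) (λ o → later (suc x) w [] o p)
        regroup : ∀ a b c → a * (b * c) ≡ b * (a * c)
        regroup = solve-∀

      -- A union bound over the `m` moments and all ports.
      ∑-crowds : .{{_ : NonZero m}} → ∀ R → length R ≡ m →
        2 ^ b * ∑ (orderings R) (crowds []) ≤ m * (length ports * m !)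
      ∑-crowds R len = begin
        2 ^ b * ∑ (orderings R) (crowds [])
          ≤⟨ *-monoʳ-≤ (2 ^ b) (∑-mono-All (All.map (λ {o} q → ≤-trans (crowds≤later [] o)
               (≤-reflexive (cong (λ z → ∑ (upTo z) (λ y → ∑ ports (later y (threshold y) [] o))) (trans (↭-length q) len))))
               (orderings-↭ R))) ⟩
        2 ^ b * ∑ (orderings R) (λ o → ∑ (upTo m) (λ y → ∑ ports (later y (threshold y) [] o)))
          ≡⟨ cong (2 ^ b *_) (trans (∑-swap (orderings R) (upTo m) _)
               (∑-cong (upTo m) λ y → ∑-swap (orderings R) ports _)) ⟩
        2 ^ b * ∑ (upTo m) (λ y → ∑ ports (λ p → ∑ (orderings R) (λ o → later y (threshold y) [] o p)))
          ≡⟨ trans (∑-cong (upTo m) λ y → ∑-*ˡ ports (2 ^ b) _) (∑-*ˡ (upTo m) (2 ^ b) _) ⟨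
        ∑ (upTo m) (λ y → ∑ ports (λ p → 2 ^ b * ∑ (orderings R) (λ o → later y (threshold y) [] o p)))
          ≤⟨ ∑-mono (upTo m) (λ y → ∑-mono ports λ p →
               ≤-trans (∑-later-threshold y R p (≤-reflexive len)) (≤-reflexive (cong _! len))) ⟩
        ∑ (upTo m) (λ y → ∑ ports (λ p → m !))
          ≡⟨ trans (∑-const (upTo m) _) (cong₂ _*_ (length-upTo m) (∑-const ports (m !))) ⟩
        m * (length ports * m !) ∎
        where open ≤-Reasoning

      open Rates β m

      open Average rate rate-bound

      ∑-Tot′-total : .{{_ : NonZero m}} → ∀ t R → length R ≡ m → m < 2 ^ t →
        ∑ (orderings R) (Tot′ []) ≤ m ! * (m * (4 * (5 + 4 * b * t)))
      ∑-Tot′-total t R len m<2^t = *-cancelˡ-≤ m (begin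
        m * ∑ (orderings R) (Tot′ [])
          ≤⟨ ∑-Tot′ m R [] len len ⟩
        m ! * ∑ R (λ e → ∑ sides (pot m [] e))
          -- With empty history every `N` and every `free` is 1, so each end of each edge starts
          -- with potential `2 * (m + Φ m)`.
          ≡⟨ cong (m ! *_) (trans (∑-const R _) (cong (_* ∑ sides (λ _ → m * 1 + 1 * (1 * Φ m + (m + Φ m)))) len)) ⟩
        m ! * (m * ∑ sides (λ _ → m * 1 + 1 * (1 * Φ m + (m + Φ m))))
          ≡⟨ regroup₁ (m !) m (Φ m) ⟩
        m ! * (m * (4 * (m + Φ m)))
          ≤⟨ *-monoʳ-≤ (m !) (*-monoʳ-≤ m (*-monoʳ-≤ 4 (+-monoʳ-≤ m (Φ≤ Φ refl (λ r → refl) t m<2^t)))) ⟩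
        m ! * (m * (4 * (m + 2 * (2 * m + β * m * t))))
          ≡⟨ regroup₂ (m !) m b t ⟩
        m * (m ! * (m * (4 * (5 + 4 * b * t)))) ∎)
        where
        open ≤-Reasoning
        regroup₁ : ∀ f m q → f * (m * (m * 1 + 1 * (1 * q + (m + q)) + (m * 1 + 1 * (1 * q + (m + q)) + 0))) ≡ f * (m * (4 * (m + q)))
        regroup₁ = solve-∀
        regroup₂ : ∀ f m b t → f * (m * (4 * (m + 2 * (2 * m + 2 * b * m * t)))) ≡ m * (f * (m * (4 * (5 + 4 * b * t))))
        regroup₂ = solve-∀

  -- The memoised oracle

  module Ends {n : ℕ} (K : ℕ) (G : Graph n) where

    open PortMultigraph K G

    end : Edge → Bool → Port n
    end e false = proj₁ (ports e)
    end e true  = proj₂ (ports e)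

    vert : Edge → Bool → Fin n
    vert e i = proj₁ (end e i)

    _≟ₚ_ : DecidableEquality (Port n)
    _≟ₚ_ = ≡-dec Fin._≟_ Fin._≟_

    copies-distinct : ∀ {uv : Fin n × Fin n} → proj₁ uv ≢ proj₂ uv →
      All (λ (pq : Port n × Port n) → proj₁ (proj₁ pq) ≢ proj₁ (proj₂ pq)) (copies K uv)
    copies-distinct u≢v = u≢v ∷ u≢v ∷ All.replicate⁺ K u≢v

    portPairs-distinct : All (λ (pq : Port n × Port n) → proj₁ (proj₁ pq) ≢ proj₁ (proj₂ pq)) (portPairs K G)
    portPairs-distinct = All.concat⁺ (All.map⁺ (All.map
      (λ (u<v , _) → copies-distinct λ u≡v → Fin.<⇒≢ u<v u≡v)
      (All.all-filter (λ (u , v) → (u Fin.<? v) ×-dec (Graph._~?_ G u v)) (cartesianProduct (allFin n) (allFin n)))))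

    vert-distinct : ∀ e → vert e false ≢ vert e true
    vert-distinct e = All.lookup portPairs-distinct (∈-lookup e)

    loopless : ∀ e → end e false ≢ end e true
    loopless e eq = vert-distinct e (cong proj₁ eq)

    vert-injective : ∀ e i j → vert e i ≡ vert e j → i ≡ j
    vert-injective e false false eq = refl
    vert-injective e false true  eq = contradiction eq (vert-distinct e)
    vert-injective e true  false eq = contradiction (sym eq) (vert-distinct e)
    vert-injective e true  true  eq = refl

    opposite-vert : ∀ e i → opposite e (vert e i) ≡ vert e (not i)
    opposite-vert e false = cong (if_then vert e true else vert e false)
      (dec-true (vert e false Fin.≟ vert e false) refl)
    opposite-vert e true = cong (if_then vert e true else vert e false)
      (dec-false (vert e true Fin.≟ vert e false) (vert-distinct e ∘ sym))

    occupies-end : ∀ {e p} → Occupies e p → ∃ λ i → end e i ≡ p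
    occupies-end (inj₁ eq) = false , eq
    occupies-end (inj₂ eq) = true , eq

    end-occupies : ∀ e i → Occupies e (end e i)
    end-occupies e false = inj₁ refl
    end-occupies e true  = inj₂ refl

    conflictAt-ends : ∀ {w e f} → ConflictAt w e f → ∃₂ λ i j → end f j ≡ end e i × vert e i ≡ w
    conflictAt-ends (k , e∋p , f∋p) with occupies-end e∋p | occupies-end f∋p
    ... | i , eq | j , eq′ = i , j , trans eq′ (sym eq) , cong proj₁ eq

    ends-conflictAt : ∀ {e f} i j → end f j ≡ end e i → ConflictAt (vert e i) e f
    ends-conflictAt {e} {f} i j eq = proj₂ (end e i) , end-occupies e i , subst (Occupies f) eq (end-occupies f j)

    -- The second argument of `EO` is the endpoint away from the caller, so entering `e` through end
    -- `i` is the call with `vert e (not i)`. An edge in conflict at both ends counts as a far one,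
    -- because `unshared` tests that endpoint.
    unshared-far : ∀ {e f} i → ConflictAt (vert e (not i)) e f →
      ∃ λ j → unshared e (vert e (not i)) f ≡ vert f (not j) × end f j ≡ end e (not i)
    unshared-far {e} {f} i c with conflictAt-ends {f = f} c
    ... | i′ , j , ends , verts with vert-injective e i′ (not i) verts
    ... | refl = j
      , trans (cong (if_then opposite f (vert e (not i)) else opposite f (opposite e (vert e (not i))))
                 (dec-true (conflictAt? (vert e (not i)) e f) c))
              (trans (cong (opposite f ∘ proj₁) (sym ends)) (opposite-vert f j))
      , ends

    unshared-near : ∀ {e f} i → ¬ ConflictAt (vert e (not i)) e f → Conflict e f →
      ∃ λ j → unshared e (vert e (not i)) f ≡ vert f (not j) × end f j ≡ end e i
    unshared-near {e} {f} i ¬c (w , c) with conflictAt-ends {f = f} c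
    ... | i′ , j , ends , _ = j
      , trans (cong (if_then opposite f (vert e (not i)) else opposite f (opposite e (vert e (not i))))
                 (dec-false (conflictAt? (vert e (not i)) e f) ¬c))
              (trans (cong (opposite f) (trans (opposite-vert e (not i)) (trans (cong (vert e) (not-involutive i)) (cong proj₁ (sym near)))))
                     (opposite-vert f j))
      , near
      where
      same : ∀ i i′ → i′ ≢ not i → i′ ≡ i
      same false false _ = refl
      same false true  h = contradiction refl h
      same true  false h = contradiction refl h
      same true  true  _ = refl
      near : end f j ≡ end e i
      near = trans ends (cong (end e) (same i i′ λ { refl → ¬c (ends-conflictAt {e} {f} (not i) j ends) }))

  take-length-++ : ∀ {A : Set} (ys : List A) {zs} k → take (length ys + k) (ys ++ zs) ≡ ys ++ take k zs
  take-length-++ []       k = refl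
  take-length-++ (y ∷ ys) k = cong (y ∷_) (take-length-++ ys k)

  tabulate-split : ∀ {A : Set} {n} (g : Fin n → A) ys {x zs} → tabulate g ≡ ys ++ x ∷ zs →
    ∃ λ i → toℕ i ≡ length ys × g i ≡ x
  tabulate-split {n = zero}  g []       ()
  tabulate-split {n = zero}  g (y ∷ ys) ()
  tabulate-split {n = suc n} g []       eq = zero , refl , ∷-injectiveˡ eq
  tabulate-split {n = suc n} g (y ∷ ys) eq with tabulate-split (g ∘ suc) ys (∷-injectiveʳ eq)
  ... | i , toℕ≡ , gi≡ = suc i , cong suc toℕ≡ , gi≡

  ∑-strict : ∀ {A : Set} {φ ψ : A → ℕ} {xs x} → x ∈ xs → (∀ y → φ y ≤ ψ y) → suc (φ x) ≤ ψ x →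
    suc (∑ xs φ) ≤ ∑ xs ψ
  ∑-strict {xs = _ ∷ xs} (here refl) le lt = +-mono-≤ lt (∑-mono xs le)
  ∑-strict {φ = φ} {xs = y ∷ xs} (there x∈) le lt =
    ≤-trans (≤-reflexive (sym (+-suc (φ y) _))) (+-mono-≤ (le y) (∑-strict x∈ le lt))

  -- Chains the costs of two stages of a scan. Each stage costs at most the increase of `N`, written
  -- with sums to avoid truncated subtraction.
  add-costs : ∀ c₂ c₁ c₀ n₁ n₂ n₃ → c₁ + n₁ ≤ c₀ + n₂ → c₂ + n₂ ≤ c₁ + n₃ → c₂ + n₁ ≤ c₀ + n₃
  add-costs c₂ c₁ c₀ n₁ n₂ n₃ le₁ le₂ = +-cancelʳ-≤ n₂ (c₂ + n₁) (c₀ + n₃) (begin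
    c₂ + n₁ + n₂     ≡⟨ regroup c₂ n₁ n₂ ⟩
    c₂ + n₂ + n₁     ≤⟨ +-monoˡ-≤ n₁ le₂ ⟩
    c₁ + n₃ + n₁     ≡⟨ regroup c₁ n₃ n₁ ⟩
    c₁ + n₁ + n₃     ≤⟨ +-monoˡ-≤ n₃ le₁ ⟩
    c₀ + n₂ + n₃     ≡⟨ regroup c₀ n₂ n₃ ⟩
    c₀ + n₃ + n₂     ∎)
    where
    open ≤-Reasoning
    regroup : ∀ a b c → a + b + c ≡ a + c + b
    regroup = solve-∀

  indicator : ∀ {n} → Fin n → Fin n → ℕ
  indicator v w = if does (v Fin.≟ w) then 1 else 0

  indicator-≡ : ∀ {n} {v w : Fin n} → v ≡ w → indicator v w ≡ 1
  indicator-≡ {v = v} {w} eq = cong (if_then 1 else 0) (dec-true (v Fin.≟ w) eq)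

  ∑-indicator : ∀ {n} (v : Fin n) → ∑ (allFin n) (indicator v) ≡ 1
  ∑-indicator {suc n} v = trans (cong (λ vs → indicator v zero + ∑ vs (indicator v)) (sym (map-tabulate id suc)))
    (trans (cong (indicator v zero +_) (∑-map suc (allFin n) (indicator v))) (by-cases v))
    where
    by-cases : ∀ v → indicator v zero + ∑ (allFin n) (λ w → indicator v (suc w)) ≡ 1
    by-cases zero    = cong suc (trans (∑-const (allFin n) 0) (*-zeroʳ (length (allFin n))))
    by-cases (suc v) = ∑-indicator v

  -- The oracle for a fixed ranking

  module Memo {n : ℕ} (K : ℕ) (G : Graph n) (π : Permutation′ (∣E′∣ K G)) where

    open PortMultigraph K G
    open Ends K G
    open Oracles K G π
    open Memory
    open Greedy _≟ₚ_ end loopless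

    m : ℕ
    m = ∣E′∣ K G

    finish : Edge → Fin n → Memory × Bool → Memory × Bool
    finish e u (s , b) = store e u b s , b

    -- The where-bound scan of EO-acc (and below the loop of VO) has no name outside Defs;
    -- unification with the unfolded oracle supplies it.
    mutual
      scan : (e : Edge) (u : Fin n) (rec : ∀ {y} → y <ᶠ rank e → Acc _<ᶠ_ y) (fs : List Edge) → All (LowerConflict e) fs → State Memory Bool
      scan = _

      EO-fresh : ∀ e u (rec : ∀ {y} → y <ᶠ rank e → Acc _<ᶠ_ y) s → stored s e u ≡ nothing →
         runState (EO-acc e u (acc rec)) s ≡
         finish e u (runState (scan e u (λ {y} → rec {y}) (filter (lowerConflict? e) edgesByRank) (All.all-filter (lowerConflict? e) edgesByRank)) (countCall s))
      EO-fresh e u rec s eq rewrite eq with filter (lowerConflict? e) edgesByRank | All.all-filter (lowerConflict? e) edgesByRank | countCall s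
      ... | fs | ps | s′ = refl

    EO-hit : ∀ e u (rec : ∀ {y} → y <ᶠ rank e → Acc _<ᶠ_ y) s b → stored s e u ≡ just b →
         runState (EO-acc e u (acc rec)) s ≡ (countCall s , b)
    EO-hit e u rec s b eq rewrite eq = refl

    scan-∷ : ∀ e u (rec : ∀ {y} → y <ᶠ rank e → Acc _<ᶠ_ y) f fs p ps s → runState (scan e u (λ {y} → rec {y}) (f ∷ fs) (p ∷ ps)) s ≡
         (let (s₁ , b) = runState (EO-acc f (unshared e u f) (rec (proj₂ p))) s in
          if b then (s₁ , false) else runState (scan e u (λ {y} → rec {y}) fs ps) s₁)
    scan-∷ e u rec f fs p ps s with runState (EO-acc f (unshared e u f) (rec (proj₂ p))) s
    ... | s₁ , true = refl
    ... | s₁ , false = refl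

    mutual
      loop₀ : Fin n → List Edge → State Memory ℕ
      loop₀ = _

      VO-loop : ∀ v s → runState (VO v) s ≡ runState (loop₀ v (filter (incident? v) edgesByRank)) s
      VO-loop v s with filter (incident? v) edgesByRank
      ... | fs = refl

    mutual
      loop : Fin n → List Edge → ℕ → State Memory ℕ
      loop = _

      loop₀-∷ : ∀ v s e es → runState (loop₀ v (e ∷ es)) s ≡ (let (s₁ , b) = runState (EO e (opposite e v)) s in runState (loop v es (if b then 1 else 0)) s₁)
      loop₀-∷ v s e es with runState (EO e (opposite e v)) s
      ... | s₁ , b with if b then 1 else 0
      ... | d = refl

    T-loop : ∀ v → T v ≡ calls (proj₁ (runState (loop v (filter (incident? v) edgesByRank) 0) initial))
    T-loop v = cong (λ r → calls (proj₁ r)) (VO-loop v initial)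

    EO-hit-acc : ∀ e u (a : Acc _<ᶠ_ (rank e)) s b → stored s e u ≡ just b → runState (EO-acc e u a) s ≡ (countCall s , b)
    EO-hit-acc e u (acc rec) s b eq = EO-hit e u rec s b eq

    -- The equation with `ʳ++` places a scan between the processed edges `h`, latest first, and
    -- `rest`. Moving an edge from `rest` to `h` preserves it definitionally.
    rank-split : ∀ h f rest → edgesByRank ≡ h ʳ++ (f ∷ rest) → toℕ (rank f) ≡ length h
    rank-split h f rest eq with tabulate-split (π ⟨$⟩ˡ_) (reverse h)
      (trans (sym (map-tabulate id (π ⟨$⟩ˡ_))) (trans eq (ʳ++-defn h)))
    ... | i , toℕ≡ , refl = trans (cong toℕ (inverseʳ π)) (trans toℕ≡ (length-reverse h))

    rank-injective : ∀ {e f} → toℕ (rank e) ≡ toℕ (rank f) → e ≡ f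
    rank-injective eq = trans (sym (inverseˡ π)) (trans (cong (π ⟨$⟩ˡ_) (Fin.toℕ-injective eq)) (inverseˡ π))

    length-edgesByRank : length edgesByRank ≡ m
    length-edgesByRank = trans (length-map (π ⟨$⟩ˡ_) (allFin m)) (length-tabulate {n = m} id)

    hist : Edge → List Edge
    hist e = reverse (take (toℕ (rank e)) edgesByRank)

    hist-extends : ∀ e h rest k → edgesByRank ≡ h ʳ++ rest → toℕ (rank e) ≡ length h + k →
      hist e ≡ reverse (take k rest) ++ h
    hist-extends e h rest k split eq = begin
      reverse (take (toℕ (rank e)) edgesByRank)
        ≡⟨ cong₂ (λ a b → reverse (take a b)) (trans eq (cong (_+ k) (sym (length-reverse h)))) (trans split (ʳ++-defn h)) ⟩
      reverse (take (length (reverse h) + k) (reverse h ++ rest))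
        ≡⟨ cong reverse (take-length-++ (reverse h) k) ⟩
      reverse (reverse h ++ take k rest)
        ≡⟨ reverse-++ (reverse h) (take k rest) ⟩
      reverse (take k rest) ++ reverse (reverse h)
        ≡⟨ cong (reverse (take k rest) ++_) (reverse-involutive h) ⟩
      reverse (take k rest) ++ h ∎
      where open ≡-Reasoning

    hist-at : ∀ e h rest → edgesByRank ≡ h ʳ++ rest → toℕ (rank e) ≡ length h → hist e ≡ h
    hist-at e h rest split eq = hist-extends e h rest 0 split (trans eq (sym (+-identityʳ (length h))))

    hist-beyond : ∀ e h rest → edgesByRank ≡ h ʳ++ rest → length h ≤ toℕ (rank e) → ∃ λ xs → hist e ≡ xs ++ h
    hist-beyond e h rest split le = _ , hist-extends e h rest _ split (sym (m+[n∸m]≡n le))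

    N-hist : ∀ e i h rest → edgesByRank ≡ h ʳ++ rest → length h ≤ toℕ (rank e) → N h e i ≤ N (hist e) e i
    N-hist e i h rest split le with hist-beyond e h rest split le
    ... | xs , eq = ≤-trans (N-++ xs h e i) (≤-reflexive (cong (λ z → N z e i) (sym eq)))

    live-hist : ∀ e h rest → edgesByRank ≡ h ʳ++ rest → length h ≤ toℕ (rank e) → live (hist e) e ≤ live h e
    live-hist e h rest split le with hist-beyond e h rest split le
    ... | xs , eq = ≤-trans (≤-reflexive (cong (λ z → live z e) eq)) (live-++ xs h e)

    none-lower : ∀ e h rest → edgesByRank ≡ h ʳ++ rest → toℕ (rank e) ≤ length h → filter (lowerConflict? e) rest ≡ []
    none-lower e h []         split le = refl
    none-lower e h (f ∷ rest) split le = trans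
      (filter-reject (lowerConflict? e) λ (_ , f<e) →
        <⇒≱ f<e (≤-trans le (≤-reflexive (sym (rank-split h f rest split)))))
      (none-lower e (f ∷ h) rest split (m≤n⇒m≤1+n le))

    -- Invariants of the memory

    val : Bool → ℕ
    val true  = 1
    val false = 0

    Stored : Memory → Edge → Fin n → Set
    Stored s e u = ∃ λ b → stored s e u ≡ just b

    Correct : Memory → Set
    Correct s = ∀ f w b → stored s f w ≡ just b → val b ≡ live (hist f) f

    -- The cell at `vert f (not j)` is the one filled by entering `f` through its end `j` at the
    -- port `p`.
    SeenBelow : Memory → ℕ → Port n → Set
    SeenBelow s k p = ∀ f j → toℕ (rank f) < k → end f j ≡ p → Stored s f (vert f (not j))

    empty : Maybe Bool → ℕ
    empty nothing  = 1
    empty (just _) = 0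

    unstored : Memory → ℕ
    unstored s = ∑ (allFin m) λ f → ∑ (allFin n) λ w → empty (stored s f w)

    -- Each computed call makes at most m further calls and fills one empty cell of the memory.
    weight : Memory → ℕ
    weight s = calls s + m * unstored s

    -- `frame` supports `crude`: a call leaves the cells of edges of higher rank alone, so the cell
    -- of the caller is still empty when its own result is stored.
    record Called (s : Memory) (e : Edge) (i : Bool) (r : Memory × Bool) : Set where
      field
        correct : Correct (proj₁ r)
        value   : val (proj₂ r) ≡ live (hist e) e
        grows   : ∀ f w → Stored s f w → Stored (proj₁ r) f w
        cached  : Stored (proj₁ r) e (vert e (not i))
        cost    : calls (proj₁ r) ≤ calls s + N (hist e) e i
        frame   : ∀ f w → toℕ (rank e) < toℕ (rank f) → stored (proj₁ r) f w ≡ stored s f w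
        crude   : weight (proj₁ r) ≤ weight s + 1

    record Scanned (s : Memory) (e : Edge) (i : Bool) (h : List Edge) (c : ℕ) (r : Memory × Bool) : Set where
      field
        correct : Correct (proj₁ r)
        value   : val (proj₂ r) ≡ live (hist e) e
        grows   : ∀ f w → Stored s f w → Stored (proj₁ r) f w
        cost    : calls (proj₁ r) + N h e i ≤ calls s + N (hist e) e i
        frame   : ∀ f w → toℕ (rank e) ≤ toℕ (rank f) → stored (proj₁ r) f w ≡ stored s f w
        crude   : weight (proj₁ r) ≤ weight s + c

    hit-called : ∀ e i a s → Correct s → Stored s e (vert e (not i)) →
      calls (proj₁ (runState (EO-acc e (vert e (not i)) a) s)) ≡ suc (calls s) ×
      Called s e i (runState (EO-acc e (vert e (not i)) a) s)
    hit-called e i a s correct (b , eq) = cong (calls ∘ proj₁) hit , subst (Called s e i) (sym hit) record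
      { correct = correct
      ; value   = correct e (vert e (not i)) b eq
      ; grows   = λ f w st → st
      ; cached  = b , eq
      ; cost    = ≤-trans (≤-reflexive (+-comm 1 (calls s))) (+-monoʳ-≤ (calls s) (1≤N (hist e) e i))
      ; frame   = λ f w _ → refl
      ; crude   = ≤-reflexive (+-comm 1 (weight s))
      }
      where
      hit : runState (EO-acc e (vert e (not i)) a) s ≡ (countCall s , b)
      hit = EO-hit-acc e (vert e (not i)) a s b eq

    -- The call for f in the scan of e is answered from memory if f conflicts with e only at
    -- the end i through which e was entered: the caller of e has tried f before e.
    record Stepped (s : Memory) (e : Edge) (i : Bool) (h : List Edge) (f : Edge) (r : Memory × Bool) : Set where
      field
        correct : Correct (proj₁ r)
        value   : val (proj₂ r) ≡ live h f
        grows   : ∀ f w → Stored s f w → Stored (proj₁ r) f w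
        cached  : ∀ j → end f j ≡ end e (not i) → Stored (proj₁ r) f (vert f (not j))
        cost    : calls (proj₁ r) + N h e i ≤ calls s + N (f ∷ h) e i
        frame   : ∀ g w → toℕ (rank e) ≤ toℕ (rank g) → stored (proj₁ r) g w ≡ stored s g w
        crude   : weight (proj₁ r) ≤ weight s + 1

    step-called : ∀ e i f (a : Acc _<ᶠ_ (rank f)) h rest s →
      (∀ j → SeenBelow s (toℕ (rank f)) (end f j) → Called s f j (runState (EO-acc f (vert f (not j)) a) s)) →
      edgesByRank ≡ h ʳ++ (f ∷ rest) → Conflict e f → toℕ (rank f) < toℕ (rank e) → live h e ≡ 1 →
      Correct s → SeenBelow s (toℕ (rank e)) (end e i) → SeenBelow s (length h) (end e (not i)) →
      Stepped s e i h f (runState (EO-acc f (unshared e (vert e (not i)) f) a) s)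
    step-called e i f a h rest s call split conflict f<e alive correct ready seen = by-shared (conflictAt? (vert e (not i)) e f)
      where
      h≡hist : hist f ≡ h
      h≡hist = hist-at f h (f ∷ rest) split (rank-split h f rest split)
      by-shared : Dec (ConflictAt (vert e (not i)) e f) →
        Stepped s e i h f (runState (EO-acc f (unshared e (vert e (not i)) f) a) s)
      by-shared (yes c) = subst (λ u → Stepped s e i h f (runState (EO-acc f u a) s)) (sym (proj₁ (proj₂ far))) record
        { correct = Called.correct called
        ; value   = trans (Called.value called) (cong (λ z → live z f) h≡hist)
        ; grows   = Called.grows called
        ; cached  = λ j′ eq → subst (λ k → Stored (proj₁ (runState (EO-acc f (vert f (not j)) a) s)) f (vert f (not k)))
                      (vert-injective f j j′ (cong proj₁ (trans ends (sym eq)))) (Called.cached called)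
        ; cost    = ≤-trans (+-monoˡ-≤ (N h e i) (Called.cost called))
                      (≤-trans (≤-reflexive (trans (+-assoc (calls s) _ _) (cong (λ z → calls s + (N z f j + N h e i)) h≡hist)))
                        (+-monoʳ-≤ (calls s) (N-far h f e i j alive ends)))
        ; frame   = λ g w e≤g → Called.frame called g w (<-≤-trans f<e e≤g)
        ; crude   = Called.crude called
        }
        where
        far = unshared-far {e} {f} i c
        j = proj₁ far
        ends : end f j ≡ end e (not i)
        ends = proj₂ (proj₂ far)
        called : Called s f j (runState (EO-acc f (vert f (not j)) a) s)
        -- The port through which `f` is entered is the far port of `e`, and the scan has already
        -- met every edge below `f` there.
        called = call j λ g k g<f eq → seen g k
          (<-≤-trans g<f (≤-reflexive (rank-split h f rest split))) (trans eq ends)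
      by-shared (no ¬c) = subst (λ u → Stepped s e i h f (runState (EO-acc f u a) s)) (sym (proj₁ (proj₂ near))) record
        { correct = Called.correct called
        ; value   = trans (Called.value called) (cong (λ z → live z f) h≡hist)
        ; grows   = Called.grows called
        ; cached  = λ j′ eq → contradiction (ends-conflictAt {e} {f} (not i) j′ eq) ¬c
        ; cost    = ≤-trans (≤-reflexive (trans (cong (_+ N h e i) (proj₁ hit)) (sym (+-suc (calls s) (N h e i)))))
                        (+-monoʳ-≤ (calls s) (N-near h f e i j alive ends))
        ; frame   = λ g w e≤g → Called.frame called g w (<-≤-trans f<e e≤g)
        ; crude   = Called.crude called
        }
        where
        near = unshared-near {e} {f} i ¬c conflict
        j = proj₁ near
        ends : end f j ≡ end e i
        ends = proj₂ (proj₂ near)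
        hit = hit-called f j a s correct (ready f j f<e ends)
        called : Called s f j (runState (EO-acc f (vert f (not j)) a) s)
        called = proj₂ hit

    -- The scan of the conflicts of one edge

    module _ (e : Edge) (i : Bool) (rec : ∀ {y} → y <ᶠ rank e → Acc _<ᶠ_ y)
      (call : ∀ f (f<e : rank f <ᶠ rank e) j s → Correct s → SeenBelow s (toℕ (rank f)) (end f j) →
              Called s f j (runState (EO-acc f (vert f (not j)) (rec f<e)) s)) where

      Scanning : List Edge → List Edge → Set
      Scanning h rest = ∀ fs ps s → fs ≡ filter (lowerConflict? e) rest →
        Correct s → SeenBelow s (toℕ (rank e)) (end e i) → SeenBelow s (length h) (end e (not i)) →
        Scanned s e i h (length fs) (runState (scan e (vert e (not i)) (λ {y} → rec {y}) fs ps) s)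

      scan-done : ∀ h rest → edgesByRank ≡ h ʳ++ rest → toℕ (rank e) ≡ length h → live h e ≡ 1 → Scanning h rest
      scan-done h rest split eq alive (f ∷ fs) ps s fs≡ _ _ _ =
        contradiction (trans fs≡ (none-lower e h rest split (≤-reflexive eq))) λ ()
      scan-done h rest split eq alive [] [] s fs≡ correct ready seen = record
        { correct = correct
        ; value   = trans (sym alive) (cong (λ z → live z e) (sym h≡hist))
        ; grows   = λ f w st → st
        ; cost    = ≤-reflexive (cong (λ z → calls s + N z e i) (sym h≡hist))
        ; frame   = λ f w _ → refl
        ; crude   = ≤-reflexive (sym (+-identityʳ (weight s)))
        }
        where
        h≡hist : hist e ≡ h
        h≡hist = hist-at e h rest split eq

      -- Since `f` precedes `e`, failing `LowerConflict` means sharing no port: `e` stays live, and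
      -- no new edge has to be seen at its far port.
      scan-skip : ∀ h f rest → edgesByRank ≡ h ʳ++ (f ∷ rest) → length h < toℕ (rank e) → ¬ LowerConflict e f →
        (live (f ∷ h) e ≡ live h e → Scanning (f ∷ h) rest) → Scanning h (f ∷ rest)
      scan-skip h f rest split h<e ¬lc scanning fs ps s fs≡ correct ready seen = record
        { correct = Scanned.correct scanned
        ; value   = Scanned.value scanned
        ; grows   = Scanned.grows scanned
        ; cost    = ≤-trans (+-monoʳ-≤ _ (N-∷ h f e i)) (Scanned.cost scanned)
        ; frame   = Scanned.frame scanned
        ; crude   = Scanned.crude scanned
        }
        where
        rank-f : toℕ (rank f) ≡ length h
        rank-f = rank-split h f rest split
        avoid : ∀ i j → end f j ≢ end e i
        avoid i j eq = ¬lc ((vert e i , ends-conflictAt {e} {f} i j eq) , ≤-<-trans (≤-reflexive rank-f) h<e)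
        seen′ : SeenBelow s (suc (length h)) (end e (not i))
        seen′ g j g<1+h eq =
          [ (λ g<h → seen g j g<h eq)
          , (λ g≡h → contradiction
              (subst (λ z → end z j ≡ end e (not i)) (rank-injective (trans g≡h (sym rank-f))) eq) (avoid (not i) j))
          ]′ (m<1+n⇒m<n∨m≡n g<1+h)
        scanned = scanning (live-avoid h f e avoid) fs ps s
          (trans fs≡ (filter-reject (lowerConflict? e) ¬lc)) correct ready seen′

      scan-call : ∀ h f rest → edgesByRank ≡ h ʳ++ (f ∷ rest) → length h < toℕ (rank e) → live h e ≡ 1 →
        LowerConflict e f → (live (f ∷ h) e ≡ live h e → Scanning (f ∷ h) rest) →
        ∀ fs p ps s → fs ≡ filter (lowerConflict? e) rest →
        Correct s → SeenBelow s (toℕ (rank e)) (end e i) → SeenBelow s (length h) (end e (not i)) →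
        Scanned s e i h (suc (length fs)) (runState (scan e (vert e (not i)) (λ {y} → rec {y}) (f ∷ fs) (p ∷ ps)) s)
      scan-call h f rest split h<e alive lc scanning fs p ps s fs≡ correct ready seen =
        subst (Scanned s e i h (suc (length fs))) (sym (scan-∷ e (vert e (not i)) rec f fs p ps s))
          (continue _ (step-called e i f (rec (proj₂ p)) h rest s (λ j → call f (proj₂ p) j s correct)
            split (proj₁ lc) (proj₂ lc) alive correct ready seen))
        where
        rank-f : toℕ (rank f) ≡ length h
        rank-f = rank-split h f rest split
        N≤ : N (f ∷ h) e i ≤ N (hist e) e i
        N≤ = N-hist e i (f ∷ h) rest split h<e
        clash = conflictAt-ends {f = f} (proj₂ (proj₁ lc))
        continue : ∀ r → Stepped s e i h f r → Scanned s e i h (suc (length fs))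
          (if proj₂ r then (proj₁ r , false) else runState (scan e (vert e (not i)) (λ {y} → rec {y}) fs ps) (proj₁ r))
        continue (s₁ , true) stepped = record
          { correct = Stepped.correct stepped
          -- The live `f` takes a port of `e`, and no later edge can make `e` live again; this
          -- justifies the early exit with `false`.
          ; value   = sym (n≤0⇒n≡0 (≤-trans (live-hist e (f ∷ h) rest split h<e) (≤-reflexive
                        (live-blocked h f e (proj₁ clash) (proj₁ (proj₂ clash))
                          (sym (Stepped.value stepped)) (proj₁ (proj₂ (proj₂ clash)))))))
          ; grows   = Stepped.grows stepped
          ; cost    = ≤-trans (Stepped.cost stepped) (+-monoʳ-≤ (calls s) N≤)
          ; frame   = Stepped.frame stepped
          ; crude   = ≤-trans (Stepped.crude stepped) (+-monoʳ-≤ (weight s) (s≤s z≤n))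
          }
        continue (s₁ , false) stepped = record
          { correct = Scanned.correct scanned
          ; value   = Scanned.value scanned
          ; grows   = λ g w st → Scanned.grows scanned g w (Stepped.grows stepped g w st)
          ; cost    = add-costs _ (calls s₁) (calls s) (N h e i) (N (f ∷ h) e i) (N (hist e) e i)
                        (Stepped.cost stepped) (Scanned.cost scanned)
          ; frame   = λ g w e≤g → trans (Scanned.frame scanned g w e≤g) (Stepped.frame stepped g w e≤g)
          ; crude   = ≤-trans (Scanned.crude scanned)
                        (≤-trans (+-monoˡ-≤ (length fs) (Stepped.crude stepped)) (≤-reflexive (+-assoc (weight s) 1 (length fs))))
          }
          where
          now : ∀ g j → g ≡ f → end g j ≡ end e (not i) → Stored s₁ g (vert g (not j))
          now g j refl eq = Stepped.cached stepped j eq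
          seen′ : SeenBelow s₁ (suc (length h)) (end e (not i))
          seen′ g j g<1+h eq =
            [ (λ g<h → Stepped.grows stepped g _ (seen g j g<h eq))
            , (λ g≡h → now g j (rank-injective (trans g≡h (sym rank-f))) eq)
            ]′ (m<1+n⇒m<n∨m≡n g<1+h)
          scanned : Scanned s₁ e i (f ∷ h) (length fs) (runState (scan e (vert e (not i)) (λ {y} → rec {y}) fs ps) s₁)
          scanned = scanning (live-dead h f e (sym (Stepped.value stepped))) fs ps s₁ fs≡
            (Stepped.correct stepped) (λ g j g<e eq → Stepped.grows stepped g _ (ready g j g<e eq)) seen′

      scan-accept : ∀ h f rest → edgesByRank ≡ h ʳ++ (f ∷ rest) → length h < toℕ (rank e) → live h e ≡ 1 →
        LowerConflict e f → (live (f ∷ h) e ≡ live h e → Scanning (f ∷ h) rest) → Scanning h (f ∷ rest)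
      scan-accept h f rest split h<e alive lc scanning [] ps s fs≡ _ _ _ =
        contradiction (trans fs≡ (filter-accept (lowerConflict? e) lc)) λ ()
      scan-accept h f rest split h<e alive lc scanning (f′ ∷ fs) (p ∷ ps) s fs≡ =
        same (∷-injectiveˡ split-fs) p
        where
        split-fs : f′ ∷ fs ≡ f ∷ filter (lowerConflict? e) rest
        split-fs = trans fs≡ (filter-accept (lowerConflict? e) lc)
        same : ∀ {f′} → f′ ≡ f → (p : LowerConflict e f′) →
          Correct s → SeenBelow s (toℕ (rank e)) (end e i) → SeenBelow s (length h) (end e (not i)) →
          Scanned s e i h (suc (length fs)) (runState (scan e (vert e (not i)) (λ {y} → rec {y}) (f′ ∷ fs) (p ∷ ps)) s)
        same refl p = scan-call h f rest split h<e alive lc scanning fs p ps s (∷-injectiveʳ split-fs)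

      -- The induction follows the whole ranking, not only the filtered list, because `N` and `live`
      -- are defined along full histories. `live h e ≡ 1` persists as the scan stops at the first
      -- live conflict.
      scanning : ∀ h rest → edgesByRank ≡ h ʳ++ rest → length h ≤ toℕ (rank e) → live h e ≡ 1 → Scanning h rest
      scanning-∷ : ∀ h f rest → edgesByRank ≡ h ʳ++ (f ∷ rest) → length h < toℕ (rank e) → live h e ≡ 1 →
        Dec (LowerConflict e f) → Scanning h (f ∷ rest)
      -- The ranking cannot be exhausted before the position of `e` is reached.
      scanning h [] split h≤e alive = contradiction (Fin.toℕ<n (rank e)) (≤⇒≯ (begin
        m                        ≡⟨ length-edgesByRank ⟨
        length edgesByRank       ≡⟨ cong length (trans split (ʳ++-defn h)) ⟩
        length (reverse h ++ []) ≡⟨ trans (cong length (++-identityʳ (reverse h))) (length-reverse h) ⟩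
        length h                 ≤⟨ h≤e ⟩
        toℕ (rank e)             ∎))
        where open ≤-Reasoning
      scanning h (f ∷ rest) split h≤e alive =
        [ (λ h<e → scanning-∷ h f rest split h<e alive (lowerConflict? e f))
        , (λ h≡e → scan-done h (f ∷ rest) split (sym h≡e) alive)
        ]′ (m≤n⇒m<n∨m≡n h≤e)
      scanning-∷ h f rest split h<e alive (yes lc) = scan-accept h f rest split h<e alive lc
        λ same → scanning (f ∷ h) rest split h<e (trans same alive)
      scanning-∷ h f rest split h<e alive (no ¬lc) = scan-skip h f rest split h<e ¬lc
        λ same → scanning (f ∷ h) rest split h<e (trans same alive)
    store-hit : ∀ e u b s → stored (store e u b s) e u ≡ just b
    store-hit e u b s = cong (if_then just b else stored s e u) (dec-true ((e Fin.≟ e) ×-dec (u Fin.≟ u)) (refl , refl))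

    store-miss : ∀ e u b s f w → ¬ (f ≡ e × w ≡ u) → stored (store e u b s) f w ≡ stored s f w
    store-miss e u b s f w ≢ = cong (if_then just b else stored s f w) (dec-false ((f Fin.≟ e) ×-dec (w Fin.≟ u)) ≢)

    unstored-store : ∀ e u b s → stored s e u ≡ nothing → suc (unstored (store e u b s)) ≤ unstored s
    unstored-store e u b s eq = ∑-strict (∈-allFin e) (λ f → ∑-mono (allFin n) (fewer f)) (∑-strict (∈-allFin u) (fewer e) strict)
      where
      fewer : ∀ f w → empty (stored (store e u b s) f w) ≤ empty (stored s f w)
      fewer f w = by-dec ((f Fin.≟ e) ×-dec (w Fin.≟ u))
        where
        by-dec : Dec (f ≡ e × w ≡ u) → empty (stored (store e u b s) f w) ≤ empty (stored s f w)
        by-dec (yes (refl , refl)) = ≤-trans (≤-reflexive (cong empty (store-hit e u b s))) z≤n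
        by-dec (no ≢) = ≤-reflexive (cong empty (store-miss e u b s f w ≢))
      strict : suc (empty (stored (store e u b s) e u)) ≤ empty (stored s e u)
      strict = ≤-reflexive (trans (cong (suc ∘ empty) (store-hit e u b s)) (sym (cong empty eq)))

    finished : ∀ e i s r c → c ≤ m → stored s e (vert e (not i)) ≡ nothing →
      Scanned (countCall s) e i [] c r → Called s e i (finish e (vert e (not i)) r)
    finished e i s (s₁ , b) c c≤m fresh scanned = record
      { correct = λ f w b′ eq → correct′ f w b′ eq ((f Fin.≟ e) ×-dec (w Fin.≟ u))
      ; value   = Scanned.value scanned
      ; grows   = λ f w st → keep f w (Scanned.grows scanned f w st) ((f Fin.≟ e) ×-dec (w Fin.≟ u))
      ; cached  = b , store-hit e u b s₁
      -- The call counted on entry cancels against the initial value 1 of `N [] e i`.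
      ; cost    = ≤-pred (≤-trans (≤-reflexive (+-comm 1 (calls s₁))) (Scanned.cost scanned))
      ; frame   = λ f w e<f → trans (store-miss e u b s₁ f w λ (f≡e , _) → <-irrefl (cong (toℕ ∘ rank) (sym f≡e)) e<f)
                                    (Scanned.frame scanned f w (<⇒≤ e<f))
      -- Filling the empty cell releases `m`, which covers the `c` calls of the scan; only the call
      -- on entry remains.
      ; crude   = +-cancelʳ-≤ m _ _ (begin
          weight (store e u b s₁) + m                      ≡⟨ regroup (calls s₁) m (unstored (store e u b s₁)) ⟩
          calls s₁ + m * suc (unstored (store e u b s₁))   ≤⟨ +-monoʳ-≤ (calls s₁) (*-monoʳ-≤ m (unstored-store e u b s₁
                                                                (trans (Scanned.frame scanned e u ≤-refl) fresh))) ⟩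
          weight s₁                                        ≤⟨ Scanned.crude scanned ⟩
          suc (weight s) + c                               ≤⟨ +-monoʳ-≤ (suc (weight s)) c≤m ⟩
          suc (weight s) + m                               ≡⟨ cong (_+ m) (+-comm 1 (weight s)) ⟩
          weight s + 1 + m                                 ∎)
      }
      where
      open ≤-Reasoning
      u = vert e (not i)
      regroup : ∀ a b c → a + b * c + b ≡ a + b * (1 + c)
      regroup = solve-∀
      correct′ : ∀ f w b′ → stored (store e u b s₁) f w ≡ just b′ → Dec (f ≡ e × w ≡ u) → val b′ ≡ live (hist f) f
      correct′ f w b′ eq (yes (refl , refl)) =
        trans (cong val (just-injective (trans (sym eq) (store-hit e u b s₁)))) (Scanned.value scanned)
      correct′ f w b′ eq (no ≢) = Scanned.correct scanned f w b′ (trans (sym (store-miss e u b s₁ f w ≢)) eq)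
      keep : ∀ f w → Stored s₁ f w → Dec (f ≡ e × w ≡ u) → Stored (store e u b s₁) f w
      keep f w st         (yes (refl , refl)) = b , store-hit e u b s₁
      keep f w (b′ , eq) (no ≢)              = b′ , trans (store-miss e u b s₁ f w ≢) eq

    -- The hypothesis on SeenBelow holds because the caller of e scans its conflicts by rank.
    EO-called : ∀ e i (a : Acc _<ᶠ_ (rank e)) s → Correct s → SeenBelow s (toℕ (rank e)) (end e i) →
      Called s e i (runState (EO-acc e (vert e (not i)) a) s)
    EO-called e i (acc rec) s correct ready = by-memory (stored s e (vert e (not i))) refl
      where
      by-memory : ∀ x → stored s e (vert e (not i)) ≡ x → Called s e i (runState (EO-acc e (vert e (not i)) (acc rec)) s)
      by-memory (just b) eq = proj₂ (hit-called e i (acc rec) s correct (b , eq))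
      by-memory nothing  eq = subst (Called s e i) (sym (EO-fresh e (vert e (not i)) rec s eq))
        (finished e i s _ _
          (≤-trans (length-filter (lowerConflict? e) edgesByRank) (≤-reflexive length-edgesByRank)) eq
          (scanning e i rec (λ f f<e j s′ → EO-called f j (rec f<e) s′) [] edgesByRank refl z≤n refl _ _ (countCall s) refl
            correct ready (λ f j ())))

    -- The loop of the vertex oracle

    SeenAt : Memory → ℕ → Fin n → Set
    SeenAt s k v = ∀ f j → toℕ (rank f) < k → vert f j ≡ v → Stored s f (vert f (not j))

    TotAt : Fin n → List Edge → List Edge → ℕ
    TotAt v h []      = 0
    TotAt v h (f ∷ o) = ∑ sides (λ i → indicator (vert f i) v * N h f i) + TotAt v (f ∷ h) o

    ∑-TotAt : ∀ h o → ∑ (allFin n) (λ v → TotAt v h o) ≡ Tot h o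
    ∑-TotAt h []      = trans (∑-const (allFin n) 0) (*-zeroʳ (length (allFin n)))
    ∑-TotAt h (f ∷ o) = trans (∑-+ (allFin n) (λ v → ∑ sides (λ i → indicator (vert f i) v * N h f i)) (λ v → TotAt v (f ∷ h) o))
      (cong₂ _+_
        (trans (∑-swap (allFin n) sides (λ v i → indicator (vert f i) v * N h f i)) (∑-cong sides λ i →
          trans (∑-*ʳ (allFin n) (N h f i) (indicator (vert f i)))
            (trans (cong (_* N h f i) (∑-indicator (vert f i))) (*-identityˡ (N h f i)))))
        (∑-TotAt (f ∷ h) o))

    record Looped (s : Memory) (v : Fin n) (h rest : List Edge) (c : ℕ) (s′ : Memory) : Set where
      field
        cost  : calls s′ ≤ calls s + TotAt v h rest
        crude : weight s′ ≤ weight s + c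

    Looping : Fin n → List Edge → List Edge → Set
    Looping v h rest = ∀ es d s → es ≡ filter (incident? v) rest → Correct s → SeenAt s (length h) v →
      Looped s v h rest (length es) (proj₁ (runState (loop v es d) s))

    loop-skip : ∀ v h f rest → edgesByRank ≡ h ʳ++ (f ∷ rest) → ¬ Incident v f →
      Looping v (f ∷ h) rest → Looping v h (f ∷ rest)
    loop-skip v h f rest split ¬inc looping es d s es≡ correct seen = record
      { cost  = ≤-trans (Looped.cost looped) (+-monoʳ-≤ (calls s) (m≤n+m _ _))
      ; crude = Looped.crude looped
      }
      where
      seen′ : SeenAt s (suc (length h)) v
      seen′ g j g<1+h eq =
        [ (λ g<h → seen g j g<h eq)
        , (λ g≡h → contradiction
            (subst (Incident v) (rank-injective (trans g≡h (sym (rank-split h f rest split))))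
              (subst (λ w → Incident w g) eq (proj₂ (end g j) , end-occupies g j))) ¬inc)
        ]′ (m<1+n⇒m<n∨m≡n g<1+h)
      looped = looping es d s (trans es≡ (filter-reject (incident? v) ¬inc)) correct seen′

    loop-call : ∀ v h f rest → edgesByRank ≡ h ʳ++ (f ∷ rest) → Incident v f →
      Looping v (f ∷ h) rest → ∀ es d s → es ≡ filter (incident? v) rest → Correct s → SeenAt s (length h) v →
      Looped s v h (f ∷ rest) (suc (length es)) (proj₁ (runState (loop v (f ∷ es) d) s))
    loop-call v h f rest split (k , inc) looping es d s es≡ correct seen =
      continue (runState (EO f (opposite f v)) s) (subst (λ u → Called s f j (runState (EO f u) s)) (sym opp) called)
      where
      j = proj₁ (occupies-end {f} inc)
      vert≡ : vert f j ≡ v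
      vert≡ = cong proj₁ (proj₂ (occupies-end {f} inc))
      opp : opposite f v ≡ vert f (not j)
      opp = trans (cong (opposite f) (sym vert≡)) (opposite-vert f j)
      rank-f : toℕ (rank f) ≡ length h
      rank-f = rank-split h f rest split
      called : Called s f j (runState (EO f (vert f (not j))) s)
      -- The loop meets the edges at both ports of `v` by rank, hence in particular all lower edges
      -- at the port that `f` occupies.
      called = EO-called f j _ s correct λ g i g<f eq →
        seen g i (<-≤-trans g<f (≤-reflexive rank-f)) (trans (cong proj₁ eq) vert≡)
      share : N (hist f) f j ≤ ∑ sides (λ i → indicator (vert f i) v * N h f i)
      share = ≤-trans (≤-reflexive (trans (cong (λ z → N z f j) (hist-at f h (f ∷ rest) split rank-f))
          (sym (trans (cong (_* N h f j) (indicator-≡ vert≡)) (*-identityˡ (N h f j))))))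
        (term≤∑-sides (λ i → indicator (vert f i) v * N h f i) j)
      continue : ∀ r → Called s f j r → Looped s v h (f ∷ rest) (suc (length es))
        (proj₁ (runState (loop v es (if proj₂ r then suc d else d)) (proj₁ r)))
      continue (s₁ , b) called = record
        { cost  = ≤-trans (Looped.cost looped) (≤-trans (+-monoˡ-≤ _ (≤-trans (Called.cost called) (+-monoʳ-≤ (calls s) share)))
                    (≤-reflexive (+-assoc (calls s) _ _)))
        ; crude = ≤-trans (Looped.crude looped) (≤-trans (+-monoˡ-≤ (length es) (Called.crude called))
                    (≤-reflexive (+-assoc (weight s) 1 (length es))))
        }
        where
        now : ∀ g i → g ≡ f → vert g i ≡ v → Stored s₁ g (vert g (not i))
        now g i refl eq = subst (λ z → Stored s₁ f (vert f (not z))) (vert-injective f j i (trans vert≡ (sym eq))) (Called.cached called)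
        seen′ : SeenAt s₁ (suc (length h)) v
        seen′ g i g<1+h eq =
          [ (λ g<h → Called.grows called g _ (seen g i g<h eq))
          , (λ g≡h → now g i (rank-injective (trans g≡h (sym rank-f))) eq)
          ]′ (m<1+n⇒m<n∨m≡n g<1+h)
        looped : Looped s₁ v (f ∷ h) rest (length es) (proj₁ (runState (loop v es (if b then suc d else d)) s₁))
        looped = looping es (if b then suc d else d) s₁ es≡ (Called.correct called) seen′

    loop-accept : ∀ v h f rest → edgesByRank ≡ h ʳ++ (f ∷ rest) → Incident v f →
      Looping v (f ∷ h) rest → Looping v h (f ∷ rest)
    loop-accept v h f rest split inc looping [] d s es≡ _ _ =
      contradiction (trans es≡ (filter-accept (incident? v) inc)) λ ()
    loop-accept v h f rest split inc looping (f′ ∷ es) d s es≡ = same (∷-injectiveˡ split-es)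
      where
      split-es : f′ ∷ es ≡ f ∷ filter (incident? v) rest
      split-es = trans es≡ (filter-accept (incident? v) inc)
      same : ∀ {f′} → f′ ≡ f → Correct s → SeenAt s (length h) v →
        Looped s v h (f ∷ rest) (suc (length es)) (proj₁ (runState (loop v (f′ ∷ es) d) s))
      same refl = loop-call v h f rest split inc looping es d s (∷-injectiveʳ split-es)

    looping : ∀ v h rest → edgesByRank ≡ h ʳ++ rest → Looping v h rest
    looping v h [] split [] d s es≡ correct seen = record
      { cost  = ≤-reflexive (sym (+-identityʳ (calls s)))
      ; crude = ≤-reflexive (sym (+-identityʳ (weight s)))
      }
    looping v h (f ∷ rest) split = by-dec (incident? v f)
      where
      by-dec : Dec (Incident v f) → Looping v h (f ∷ rest)
      by-dec (yes inc) = loop-accept v h f rest split inc (looping v (f ∷ h) rest split)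
      by-dec (no ¬inc) = loop-skip v h f rest split ¬inc (looping v (f ∷ h) rest split)

    T-looped : ∀ v → Looped initial v [] edgesByRank (length (filter (incident? v) edgesByRank))
      (proj₁ (runState (loop v (filter (incident? v) edgesByRank) 0) initial))
    T-looped v = looping v [] edgesByRank refl (filter (incident? v) edgesByRank) 0 initial refl (λ f w b ()) (λ f j ())

    T-cost : ∀ v → T v ≤ TotAt v [] edgesByRank
    T-cost v = ≤-trans (≤-reflexive (T-loop v)) (Looped.cost (T-looped v))

    -- All `m * n` cells are empty at the start, so the initial weight is `m * (m * n)`; each of the
    -- at most `m` calls made by the loop raises the weight by at most 1.
    T-crude : ∀ v → T v ≤ m * (m * n) + m
    T-crude v = begin
      T v                       ≡⟨ T-loop v ⟩
      _                         ≤⟨ m≤m+n _ _ ⟩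
      _                         ≤⟨ Looped.crude (T-looped v) ⟩
      m * unstored initial + length (filter (incident? v) edgesByRank)
        ≤⟨ +-mono-≤ (≤-reflexive (cong (m *_) all-empty))
             (≤-trans (length-filter (incident? v) edgesByRank) (≤-reflexive length-edgesByRank)) ⟩
      m * (m * n) + m           ∎
      where
      open ≤-Reasoning
      all-empty : unstored initial ≡ m * n
      all-empty = trans (∑-const (allFin m) (∑ (allFin n) (λ _ → 1))) (cong₂ _*_ (length-tabulate {n = m} id)
        (trans (∑-const (allFin n) 1) (trans (*-identityʳ _) (length-tabulate {n = n} id))))

  -- Averaging over vertices and permutations

  length-∑ : ∀ {A : Set} (xs : List A) → length xs ≡ ∑ xs (λ _ → 1)
  length-∑ xs = sym (trans (∑-const xs 1) (*-identityʳ (length xs)))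

  length-cartesianProduct : ∀ {A B : Set} (xs : List A) (ys : List B) →
    length (cartesianProduct xs ys) ≡ length xs * length ys
  length-cartesianProduct xs ys = begin
    length (cartesianProduct xs ys)         ≡⟨ length-∑ (cartesianProduct xs ys) ⟩
    ∑ (cartesianProduct xs ys) (λ _ → 1)    ≡⟨ ∑-cartesianProductWith _,_ xs ys (λ _ → 1) ⟩
    ∑ xs (λ _ → ∑ ys (λ _ → 1))             ≡⟨ ∑-const xs _ ⟩
    length xs * ∑ ys (λ _ → 1)              ≡⟨ cong (length xs *_) (length-∑ ys) ⟨
    length xs * length ys                   ∎
    where open ≡-Reasoning

  length-filter-∑ : ∀ {A : Set} {P : A → Set} (P? : ∀ x → Dec (P x)) xs →
    length (filter P? xs) ≡ ∑ xs (λ x → if does (P? x) then 1 else 0)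
  length-filter-∑ P? []       = refl
  length-filter-∑ P? (x ∷ xs) with does (P? x)
  ... | true  = cong suc (length-filter-∑ P? xs)
  ... | false = length-filter-∑ P? xs

  length-allFin : ∀ n → length (allFin n) ≡ n
  length-allFin n = length-tabulate {n = n} id

  length-allPermutations : ∀ m → length (allPermutations m) ≡ m !
  length-allPermutations m = begin
    length (allPermutations m)              ≡⟨ length-∑ (allPermutations m) ⟩
    ∑ (allPermutations m) (λ _ → 1)         ≡⟨ ∑-allPermutations m (λ _ → 1) ⟩
    ∑ (orderings (allFin m)) (λ _ → 1)      ≡⟨ ∑-orderings-const (allFin m) 1 ⟩
    length (allFin m) ! * 1                 ≡⟨ trans (*-identityʳ _) (cong _! (length-allFin m)) ⟩
    m !                                     ∎
    where open ≡-Reasoning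

  n<2^[1+⌊log₂n⌋] : ∀ n → n < 2 ^ suc ⌊log₂ n ⌋
  n<2^[1+⌊log₂n⌋] n = ≰⇒> λ le → <-irrefl refl
    (≤-trans (≤-reflexive (sym (⌊log₂[2^n]⌋≡n (suc ⌊log₂ n ⌋)))) (⌊log₂⌋-mono-≤ le))

  n<2^n : ∀ n → n < 2 ^ n
  n<2^n zero    = s≤s z≤n
  n<2^n (suc n) = begin-strict
    suc n               ≡⟨ +-comm 1 n ⟩
    n + 1               <⟨ +-mono-<-≤ (n<2^n n) (m^n>0 2 n) ⟩
    2 ^ n + 2 ^ n       ≡⟨ cong (_+_ (2 ^ n)) (+-identityʳ (2 ^ n)) ⟨
    2 ^ suc n           ∎
    where open ≤-Reasoning

  mean≡/ : ∀ {A : Set} (xs : List A) f {l} → length xs ≡ suc l → mean xs f ≡ pos (∑ xs f) ℚ./ suc l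
  mean≡/ (x ∷ xs) f refl = refl

  -- `F` stands for the number of rankings. It divides the number of runs and occurs in the bound on
  -- their sum, so it cancels and the average `D / suc n` is left.
  ratio-≤ : ∀ S l c D n L F → suc l ≡ suc n * F → S ≤ F * (c * (D * L)) →
    pos S ℚ./ suc l ℚ.≤ (pos c ℚ./ 1) ℚ.* ((pos D ℚ./ suc n) ℚ.* (pos L ℚ./ 1))
  ratio-≤ S l c D n L F 1+l≡ S≤ = ℚ.toℚᵘ-cancel-≤
    (ℚᵘ.≤-respˡ-≃ (ℚᵘ.≃-sym (ℚ.toℚᵘ-fromℚᵘ (mkℚᵘ (pos S) l)))
      (ℚᵘ.≤-respʳ-≃ (ℚᵘ.≃-sym product≃) (*≤* bound)))
    where
    product≃ : ℚ.toℚᵘ ((pos c ℚ./ 1) ℚ.* ((pos D ℚ./ suc n) ℚ.* (pos L ℚ./ 1)))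
      ℚᵘ.≃ mkℚᵘ (pos c) 0 ℚᵘ.* (mkℚᵘ (pos D) n ℚᵘ.* mkℚᵘ (pos L) 0)
    product≃ = ℚᵘ.≃-trans (ℚ.toℚᵘ-homo-* (pos c ℚ./ 1) ((pos D ℚ./ suc n) ℚ.* (pos L ℚ./ 1)))
      (ℚᵘ.*-cong (ℚ.toℚᵘ-fromℚᵘ (mkℚᵘ (pos c) 0))
        (ℚᵘ.≃-trans (ℚ.toℚᵘ-homo-* (pos D ℚ./ suc n) (pos L ℚ./ 1))
          (ℚᵘ.*-cong (ℚ.toℚᵘ-fromℚᵘ (mkℚᵘ (pos D) n)) (ℚ.toℚᵘ-fromℚᵘ (mkℚᵘ (pos L) 0)))))
    nat : S * (1 * (suc n * 1)) ≤ c * (D * L) * suc l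
    nat = begin
      S * (1 * (suc n * 1))           ≤⟨ *-monoˡ-≤ (1 * (suc n * 1)) S≤ ⟩
      F * (c * (D * L)) * (1 * (suc n * 1)) ≡⟨ regroup F (c * (D * L)) (suc n) ⟩
      c * (D * L) * (suc n * F)       ≡⟨ cong (c * (D * L) *_) 1+l≡ ⟨
      c * (D * L) * suc l             ∎
      where
      open ≤-Reasoning
      regroup : ∀ f x n → f * x * (1 * (n * 1)) ≡ x * (n * f)
      regroup = solve-∀
    bound : pos S ℤ.* pos (1 * (suc n * 1)) ℤ.≤ (pos c ℤ.* (pos D ℤ.* pos L)) ℤ.* pos (suc l)
    bound = subst₂ ℤ._≤_ (ℤ.pos-* S (1 * (suc n * 1)))
      (trans (ℤ.pos-* (c * (D * L)) (suc l))
        (cong (ℤ._* pos (suc l)) (trans (ℤ.pos-* c (D * L)) (cong (pos c ℤ.*_) (ℤ.pos-* D L)))))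
      (ℤ.+≤+ nat)

  -- The factor `2 + K` counts the copies of an edge. In the bracket, `20` and `224 * (6 + K)` come
  -- from `4 * (5 + 4 * b * t)` with `b ≤ 14 * ℓ` and `t ≤ (6 + K) * ℓ`, for `ℓ` the logarithm of
  -- `n`; the last summand is the share of the crowded rankings.
  constant : ℕ → ℕ
  constant K = (2 + K) * (20 + 224 * (6 + K) + 4 * ((2 + K) * (2 + K)))

  -- Calls summed over all vertices and all rankings

  module Total {n : ℕ} (K : ℕ) (G : Graph n) where

    open Ends K G
    open Greedy _≟ₚ_ end loopless

    m : ℕ
    m = ∣E′∣ K G

    crude : ℕ
    crude = n * (m * (m * n) + m)

    vertexPorts : List (Port n)
    vertexPorts = cartesianProduct (allFin n) (allFin 2)

    _∈vertexPorts : ∀ p → p ∈ vertexPorts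
    (v , i) ∈vertexPorts = ∈-cartesianProduct⁺ (∈-allFin v) (∈-allFin i)

    length-vertexPorts : length vertexPorts ≡ n * 2
    length-vertexPorts = trans (length-cartesianProduct (allFin n) (allFin 2)) (cong (_* 2) (length-allFin n))

    totalCalls : Permutation′ m → ℕ
    totalCalls π = ∑ (allFin n) (Oracles.T K G π)

    totalCalls≤Tot : ∀ π → totalCalls π ≤ Tot [] (Oracles.edgesByRank K G π)
    totalCalls≤Tot π = ≤-trans (∑-mono (allFin n) (Memo.T-cost K G π))
      (≤-reflexive (Memo.∑-TotAt K G π [] (Oracles.edgesByRank K G π)))

    totalCalls≤crude : ∀ π → totalCalls π ≤ crude
    totalCalls≤crude π = ≤-trans (∑-mono (allFin n) (Memo.T-crude K G π))
      (≤-reflexive (trans (∑-const (allFin n) (m * (m * n) + m)) (cong (_* (m * (m * n) + m)) (length-allFin n))))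

    allCalls : ℕ
    allCalls = ∑ (allPermutations m) totalCalls

    module _ (b : ℕ) where

      open Crowded vertexPorts _∈vertexPorts (2 * b) m

      -- As in Markov's inequality: `crowds` is a natural number, so it is at least 1 as soon as the
      -- truncation has any effect.
      totalCalls≤ : ∀ π → let o = Oracles.edgesByRank K G π in totalCalls π ≤ Tot′ [] o + crude * crowds [] o
      totalCalls≤ π = by-crowds (crowds [] o) refl
        where
        o = Oracles.edgesByRank K G π
        by-crowds : ∀ c → crowds [] o ≡ c → totalCalls π ≤ Tot′ [] o + crude * c
        by-crowds zero    eq = ≤-trans (totalCalls≤Tot π) (≤-trans (≤-reflexive (Tot≡Tot′ [] o eq)) (m≤m+n _ _))
        by-crowds (suc c) eq = ≤-trans (totalCalls≤crude π) (≤-trans (m≤m*n crude (suc c)) (m≤n+m _ _))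

      allCalls≤ : allCalls ≤ ∑ (orderings (allFin m)) (Tot′ []) + crude * ∑ (orderings (allFin m)) (crowds [])
      allCalls≤ = begin
        ∑ (allPermutations m) totalCalls
          ≤⟨ ∑-mono (allPermutations m) totalCalls≤ ⟩
        ∑ (allPermutations m) (λ π → Tot′ [] (Oracles.edgesByRank K G π) + crude * crowds [] (Oracles.edgesByRank K G π))
          ≡⟨ ∑-allPermutations m (λ o → Tot′ [] o + crude * crowds [] o) ⟩
        ∑ (orderings (allFin m)) (λ o → Tot′ [] o + crude * crowds [] o)
          ≡⟨ ∑-+ (orderings (allFin m)) (Tot′ []) (λ o → crude * crowds [] o) ⟩
        ∑ (orderings (allFin m)) (Tot′ []) + ∑ (orderings (allFin m)) (λ o → crude * crowds [] o)
          ≡⟨ cong (_+_ (∑ (orderings (allFin m)) (Tot′ []))) (∑-*ˡ (orderings (allFin m)) crude (crowds [])) ⟩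
        ∑ (orderings (allFin m)) (Tot′ []) + crude * ∑ (orderings (allFin m)) (crowds []) ∎
        where open ≤-Reasoning

      allCalls-bound : .{{_ : NonZero m}} → ∀ t q → m < 2 ^ t → crude * (n * 2) ≤ 2 ^ b * q →
        allCalls ≤ m ! * (m * (4 * (5 + 4 * b * t) + q))
      allCalls-bound t q m<2^t crude≤ = begin
        allCalls
          ≤⟨ allCalls≤ ⟩
        ∑ (orderings (allFin m)) (Tot′ []) + crude * ∑ (orderings (allFin m)) (crowds [])
          ≤⟨ +-mono-≤ (Tail.∑-Tot′-total vertexPorts _∈vertexPorts b m t (allFin m) (length-allFin m) m<2^t) rare ⟩
        m ! * (m * (4 * (5 + 4 * b * t))) + m ! * (m * q)
          ≡⟨ trans (cong (m ! *_) (*-distribˡ-+ m _ q)) (*-distribˡ-+ (m !) _ _) ⟨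
        m ! * (m * (4 * (5 + 4 * b * t) + q)) ∎
        where
        open ≤-Reasoning
        X : ℕ
        X = ∑ (orderings (allFin m)) (crowds [])
        regroup₁ : ∀ a b c → a * (b * c) ≡ b * (a * c)
        regroup₁ = solve-∀
        regroup₂ : ∀ z m p f → z * (m * (p * f)) ≡ z * p * (f * m)
        regroup₂ = solve-∀
        regroup₃ : ∀ t q f m → t * q * (f * m) ≡ t * (f * (m * q))
        regroup₃ = solve-∀
        rare : crude * X ≤ m ! * (m * q)
        rare = *-cancelˡ-≤ (2 ^ b) {{m^n≢0 2 b}} (begin
          2 ^ b * (crude * X)
            ≡⟨ regroup₁ (2 ^ b) crude X ⟩
          crude * (2 ^ b * X)
            ≤⟨ *-monoʳ-≤ crude (Tail.∑-crowds vertexPorts _∈vertexPorts b m (allFin m) (length-allFin m)) ⟩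
          crude * (m * (length vertexPorts * m !))
            ≡⟨ cong (λ z → crude * (m * (z * m !))) length-vertexPorts ⟩
          crude * (m * (n * 2 * m !))
            ≡⟨ regroup₂ crude m (n * 2) (m !) ⟩
          crude * (n * 2) * (m ! * m)
            ≤⟨ *-monoˡ-≤ (m ! * m) crude≤ ⟩
          2 ^ b * q * (m ! * m)
            ≡⟨ regroup₃ (2 ^ b) q (m !) m ⟩
          2 ^ b * (m ! * (m * q)) ∎)

    open Graph G using (degree; edges; _~_; _~?_)

    degrees : ℕ
    degrees = ∑ (allFin n) degree

    length-edges≤n² : length edges ≤ n * n
    length-edges≤n² = ≤-trans (length-filter (λ (u , v) → (u Fin.<? v) ×-dec (u ~? v)) (cartesianProduct (allFin n) (allFin n)))
      (≤-reflexive (trans (length-cartesianProduct (allFin n) (allFin n)) (cong₂ _*_ (length-allFin n) (length-allFin n))))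

    -- Dropping the condition `u < v` counts every edge from both ends; the factor 2 given away only
    -- affects the constant.
    length-edges≤degrees : length edges ≤ degrees
    length-edges≤degrees = begin
      length edges
        ≡⟨ length-filter-∑ edge? (cartesianProduct (allFin n) (allFin n)) ⟩
      ∑ (cartesianProduct (allFin n) (allFin n)) (λ uv → if does (edge? uv) then 1 else 0)
        ≡⟨ ∑-cartesianProductWith _,_ (allFin n) (allFin n) _ ⟩
      ∑ (allFin n) (λ u → ∑ (allFin n) λ v → if does (edge? (u , v)) then 1 else 0)
        ≤⟨ ∑-mono (allFin n) (λ u → ∑-mono (allFin n) (λ v → drop-< (does (u Fin.<? v)) (does (u ~? v)))) ⟩
      ∑ (allFin n) (λ u → ∑ (allFin n) λ v → if does (u ~? v) then 1 else 0)
        ≡⟨ ∑-cong (allFin n) (λ u → length-filter-∑ (u ~?_) (allFin n)) ⟨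
      degrees ∎
      where
      open ≤-Reasoning
      edge? : ∀ (uv : Fin n × Fin n) → Dec ((proj₁ uv <ᶠ proj₂ uv) × (proj₁ uv ~ proj₂ uv))
      edge? (u , v) = (u Fin.<? v) ×-dec (u ~? v)
      drop-< : ∀ x y → (if x ∧ y then 1 else 0) ≤ (if y then 1 else 0)
      drop-< false y = z≤n
      drop-< true  y = ≤-refl

    m≡ : m ≡ (2 + K) * length edges
    m≡ = begin
      m                                                 ≡⟨ length-∑ (portPairs K G) ⟩
      ∑ (portPairs K G) (λ _ → 1)                       ≡⟨ ∑-concatMap (copies K) edges (λ _ → 1) ⟩
      ∑ edges (λ uv → ∑ (copies K uv) (λ _ → 1))        ≡⟨ ∑-cong edges (λ uv → trans (sym (length-∑ (copies K uv)))
                                                             (cong (λ k → suc (suc k)) (length-replicate K))) ⟩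
      ∑ edges (λ _ → 2 + K)                             ≡⟨ ∑-const edges (2 + K) ⟩
      length edges * (2 + K)                            ≡⟨ *-comm (length edges) (2 + K) ⟩
      (2 + K) * length edges                            ∎
      where open ≡-Reasoning

    allCalls-log : 2 ≤ n → allCalls ≤ m ! * (constant K * (degrees * ⌊log₂ n ⌋ ^ 2))
    allCalls-log 2≤n = by-size m refl
      where
      open ≤-Reasoning
      -- 2^b ≥ n^7, the power of n in crude * (n * 2) after m ≤ (2 + K) n².
      ℓ b t q : ℕ
      ℓ = ⌊log₂ n ⌋
      b = 7 * suc ℓ
      t = (2 + K) + (suc ℓ + suc ℓ)
      q = 4 * ((2 + K) * (2 + K))
      1≤ℓ : 1 ≤ ℓ
      1≤ℓ = ⌊log₂⌋-mono-≤ 2≤n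
      m≤ : m ≤ (2 + K) * (n * n)
      m≤ = ≤-trans (≤-reflexive m≡) (*-monoʳ-≤ (2 + K) length-edges≤n²)
      m<2^t : m < 2 ^ t
      m<2^t = begin-strict
        m                                     ≤⟨ m≤ ⟩
        (2 + K) * (n * n)                     ≤⟨ *-monoʳ-≤ (2 + K) (*-mono-≤ (<⇒≤ (n<2^[1+⌊log₂n⌋] n)) (<⇒≤ (n<2^[1+⌊log₂n⌋] n))) ⟩
        (2 + K) * (2 ^ suc ℓ * 2 ^ suc ℓ)     <⟨ *-monoˡ-< (2 ^ suc ℓ * 2 ^ suc ℓ)
                                                   {{m*n≢0 (2 ^ suc ℓ) (2 ^ suc ℓ) {{m^n≢0 2 (suc ℓ)}} {{m^n≢0 2 (suc ℓ)}}}} (n<2^n (2 + K)) ⟩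
        2 ^ (2 + K) * (2 ^ suc ℓ * 2 ^ suc ℓ) ≡⟨ cong (2 ^ (2 + K) *_) (^-distribˡ-+-* 2 (suc ℓ) (suc ℓ)) ⟨
        2 ^ (2 + K) * 2 ^ (suc ℓ + suc ℓ)     ≡⟨ ^-distribˡ-+-* 2 (2 + K) (suc ℓ + suc ℓ) ⟨
        2 ^ t                                 ∎
      crude≤ : .{{_ : NonZero m}} → crude * (n * 2) ≤ 2 ^ b * q
      crude≤ = begin
        n * (m * (m * n) + m) * (n * 2)
          ≤⟨ *-monoˡ-≤ (n * 2) (*-monoʳ-≤ n (+-monoʳ-≤ (m * (m * n)) (m≤m*n m (m * n) {{m*n≢0 m n {{it}} {{>-nonZero (<⇒≤ 2≤n)}}}}))) ⟩
        n * (m * (m * n) + m * (m * n)) * (n * 2)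
          ≡⟨ regroup₁ n m ⟩
        m * m * (n * n * n * 4)
          ≤⟨ *-monoˡ-≤ (n * n * n * 4) (*-mono-≤ m≤ m≤) ⟩
        (2 + K) * (n * n) * ((2 + K) * (n * n)) * (n * n * n * 4)
          ≡⟨ regroup₂ (2 + K) n ⟩
        n ^ 7 * q
          ≤⟨ *-monoˡ-≤ q (^-monoˡ-≤ 7 (<⇒≤ (n<2^[1+⌊log₂n⌋] n))) ⟩
        (2 ^ suc ℓ) ^ 7 * q
          ≡⟨ cong (_* q) (trans (^-*-assoc 2 (suc ℓ) 7) (cong (2 ^_) (*-comm (suc ℓ) 7))) ⟩
        2 ^ b * q ∎
        where
        it : {{NonZero m}} → NonZero m
        it {{nz}} = nz
        regroup₁ : ∀ n m → n * (m * (m * n) + m * (m * n)) * (n * 2) ≡ m * m * (n * n * n * 4)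
        regroup₁ = solve-∀
        regroup₂ : ∀ k n → k * (n * n) * (k * (n * n)) * (n * n * n * 4)
          ≡ n * (n * (n * (n * (n * (n * (n * 1)))))) * (4 * (k * k))
        regroup₂ = solve-∀
      coefficient : 4 * (5 + 4 * b * t) + q ≤ (20 + 224 * (6 + K) + q) * ℓ ^ 2
      coefficient = begin
        4 * (5 + 4 * b * t) + q
          ≤⟨ +-monoˡ-≤ q (*-monoʳ-≤ 4 (+-monoʳ-≤ 5 (*-mono-≤ (*-monoʳ-≤ 4 b≤) t≤))) ⟩
        4 * (5 + 4 * (14 * ℓ) * ((6 + K) * ℓ)) + q
          ≡⟨ regroup₁ K ℓ q ⟩
        (20 + q) * 1 + 224 * (6 + K) * ℓ ^ 2
          -- The constant terms are absorbed since `ℓ` is at least 1, which is where `n ≥ 2` enters.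
          ≤⟨ +-monoˡ-≤ (224 * (6 + K) * ℓ ^ 2) (*-monoʳ-≤ (20 + q) (m^n>0 ℓ {{>-nonZero 1≤ℓ}} 2)) ⟩
        (20 + q) * ℓ ^ 2 + 224 * (6 + K) * ℓ ^ 2
          ≡⟨ regroup₂ K q (ℓ ^ 2) ⟩
        (20 + 224 * (6 + K) + q) * ℓ ^ 2 ∎
        where
        regroup₁ : ∀ k l q → 4 * (5 + 4 * (14 * l) * ((6 + k) * l)) + q ≡ (20 + q) * 1 + 224 * (6 + k) * (l * (l * 1))
        regroup₁ = solve-∀
        regroup₂ : ∀ k q s → (20 + q) * s + 224 * (6 + k) * s ≡ (20 + 224 * (6 + k) + q) * s
        regroup₂ = solve-∀
        regroup₃ : ∀ l → 7 * (l + l) ≡ 14 * l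
        regroup₃ = solve-∀
        regroup₄ : ∀ k l → (2 + k) * l + ((l + l) + (l + l)) ≡ (6 + k) * l
        regroup₄ = solve-∀
        1+ℓ≤ : suc ℓ ≤ ℓ + ℓ
        1+ℓ≤ = +-monoˡ-≤ ℓ 1≤ℓ
        b≤ : b ≤ 14 * ℓ
        b≤ = ≤-trans (*-monoʳ-≤ 7 1+ℓ≤) (≤-reflexive (regroup₃ ℓ))
        t≤ : t ≤ (6 + K) * ℓ
        t≤ = ≤-trans (+-mono-≤ (m≤m*n (2 + K) ℓ {{>-nonZero 1≤ℓ}}) (+-mono-≤ 1+ℓ≤ 1+ℓ≤)) (≤-reflexive (regroup₄ K ℓ))
      by-size : ∀ x → m ≡ x → allCalls ≤ m ! * (constant K * (degrees * ℓ ^ 2))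
      -- Without edges the averages over `m` make no sense, but the crude bound is then 0.
      by-size zero m≡0 = begin
        allCalls
          ≤⟨ ∑-mono (allPermutations m) (λ π → ≤-trans (totalCalls≤crude π)
               (≤-reflexive (trans (cong (λ z → n * (z * (z * n) + z)) m≡0) (*-zeroʳ n)))) ⟩
        ∑ (allPermutations m) (λ _ → 0)
          ≡⟨ trans (∑-const (allPermutations m) 0) (*-zeroʳ (length (allPermutations m))) ⟩
        0 ≤⟨ z≤n ⟩
        m ! * (constant K * (degrees * ℓ ^ 2)) ∎
      by-size (suc x) m≡1+x = begin
        allCalls
          ≤⟨ allCalls-bound b {{nz}} t q m<2^t (crude≤ {{nz}}) ⟩
        m ! * (m * (4 * (5 + 4 * b * t) + q))
          ≤⟨ *-monoʳ-≤ (m !) (*-mono-≤ (≤-trans (≤-reflexive m≡) (*-monoʳ-≤ (2 + K) length-edges≤degrees)) coefficient) ⟩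
        m ! * ((2 + K) * degrees * ((20 + 224 * (6 + K) + q) * ℓ ^ 2))
          ≡⟨ cong (m ! *_) (regroup (2 + K) degrees (20 + 224 * (6 + K) + q) (ℓ ^ 2)) ⟩
        m ! * (constant K * (degrees * ℓ ^ 2)) ∎
        where
        nz : NonZero m
        nz = subst NonZero (sym m≡1+x) _
        regroup : ∀ k d c s → k * d * (c * s) ≡ k * c * (d * s)
        regroup = solve-∀

  expectedCalls-bound : ∀ K n → 2 ≤ n → (G : Graph n) →
    expectedCalls K G ℚ.≤ (pos (constant K) ℚ./ 1) ℚ.* (Graph.averageDegree G ℚ.* (pos (⌊log₂ n ⌋ ^ 2) ℚ./ 1))
  expectedCalls-bound K (suc n) 2≤n G =
    subst₂ (λ x y → x ℚ.≤ (pos (constant K) ℚ./ 1) ℚ.* (y ℚ.* (pos (⌊log₂ suc n ⌋ ^ 2) ℚ./ 1)))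
      (sym (mean≡/ runs _ count)) (sym (mean≡/ (allFin (suc n)) (Graph.degree G) (length-allFin (suc n))))
      (ratio-≤ _ _ (constant K) degrees n (⌊log₂ suc n ⌋ ^ 2) (m !) count′ bounded)
    where
    open Total K G
    runs = cartesianProduct (allFin (suc n)) (allPermutations m)
    length-runs : length runs ≡ suc n * m !
    length-runs = trans (length-cartesianProduct (allFin (suc n)) (allPermutations m))
      (cong₂ _*_ (length-allFin (suc n)) (length-allPermutations m))
    count′ : suc (pred (suc n * m !)) ≡ suc n * m !
    count′ = suc-pred (suc n * m !) {{m*n≢0 (suc n) (m !) {{_}} {{m !≢0}}}}
    count : length runs ≡ suc (pred (suc n * m !))
    count = trans length-runs (sym count′)
    bounded : ∑ runs (λ (v , π) → Oracles.T K G π v) ≤ m ! * (constant K * (degrees * ⌊log₂ suc n ⌋ ^ 2))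
    bounded = ≤-trans (≤-reflexive (trans (∑-cartesianProductWith _,_ (allFin (suc n)) (allPermutations m) _)
      (∑-swap (allFin (suc n)) (allPermutations m) _))) (allCalls-log 2≤n)

open import Data.Integer.Base using (+_)
open import Data.Nat.Base using (ℕ; NonZero; _^_) renaming (_≤_ to _≤ℕ_)
open import Data.Nat.Logarithm using (⌊log₂_⌋)
open import Data.Product.Base using (Σ-syntax; _,_)
open import Data.Rational.Base using (ℚ; _≤_; _*_; _/_)
open Proof using (constant; expectedCalls-bound)

theorem5p4 : (K : ℕ) .{{_ : NonZero K}} →
    Σ[ C ∈ ℚ ] ((n : ℕ) → 2 ≤ℕ n → (G : Graph n) →
    expectedCalls K G ≤ C * (Graph.averageDegree G * (+ (⌊log₂ n ⌋ ^ 2) / 1)))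
theorem5p4 K = + constant K / 1 , expectedCalls-bound K
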